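{- Let $s\ge 1$ and $r_1,\dots,r_s\ge 1$ be integers such that for every $i<s$ at least one of $r_i$ and $r_{i+1}$ is equal to $1$. Then for all sufficiently large $n$ there exists a $P_{s+1}$-free family $\mathcal{F}_n\subseteq 2^{[n]}$ that is a union of full levels of $2^{[n]}$ such that $$La(n,P_{s+1},K_{r_1,r_2,\dots,r_s})=c(K_{r_1,r_2,\dots,r_s},\mathcal{F}_n).$$
   Context: $[n]=\{1,\dots,n\}$, $2^{[n]}$ is the family of all subsets of $[n]$; the full levels of $2^{[n]}$ are the families $\binom{[n]}{k}$ of all $k$-element subsets of $[n]$. For a finite poset $P$ and a family $\mathcal{F}$ of sets, a subfamily $\mathcal{G}\subseteq\mathcal{F}$ is a copy of $P$ in $\mathcal{F}$ if there is a bijection $\phi:P\to\mathcal{G}$ such that $x\le_Px'$ implies $\phi(x)\subseteq\phi(x')$ (the converse is not required). $c(P,\mathcal{F})$ is the number of copies of $P$ in $\mathcal{F}$; $\mathcal{F}$ is $P$-free if $c(P,\mathcal{F})=0$. $La(n,P,Q)=\max\{c(Q,\mathcal{F}):\mathcal{F}\subseteq 2^{[n]},\ c(P,\mathcal{F})=0\}$. $P_k$ is the chain on $k$ elements. The complete multi-level poset $K_{r_1,\dots,r_s}$ has $\sum_{i=1}^sr_i$ elements $a^i_h$ ($1\le i\le s$, $1\le h\le r_i$) with $a^i_h<a^j_l$ if and only if $i<j$. -}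

module Defs where

open import Level using (0ℓ)
open import Data.Nat.Base using (ℕ; zero; suc)
open import Data.Nat.Properties using () renaming (_≟_ to _≟ℕ_)
open import Data.Fin.Base as Fin using (Fin)
import Data.Fin.Properties as Finₚ
open import Data.Fin.Subset using (Subset; inside; outside; _⊆_; ∣_∣)
open import Data.Fin.Subset.Properties using (_⊆?_; anySubset?)
import Data.Bool.Properties as Boolₚ
open import Data.Vec.Base as Vec using (Vec; []; _∷_)
import Data.Vec.Properties as Vecₚ
open import Data.List.Base as List
  using (List; []; _∷_; _++_; map; filter; length; allFin; concatMap)
open import Data.List.Extrema.Nat using (max)
open import Data.List.Membership.Propositional using (_∈_; find; lose)
open import Data.List.Membership.Propositional.Properties
  using (∈-allFin; ∈-map⁺; ∈-concatMap⁺)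
import Data.List.Membership.DecPropositional as DecMembership
import Data.List.Relation.Unary.All as All
open import Data.List.Relation.Unary.Any using (any?; index)
import Data.List.Relation.Unary.Any.Properties as Anyₚ
open import Data.Product.Base using (∃; ∃-syntax; Σ-syntax; _×_; _,_; proj₁)
open import Data.Product.Properties using () renaming (≡-dec to Σ-≡-dec)
open import Data.Sum.Base using (_⊎_; inj₁; inj₂)
open import Data.Empty using (⊥-elim)
open import Function.Base using (_∘_)
open import Function.Bundles using (_⇔_)
open import Function.Definitions using (Injective)
open import Relation.Nullary.Decidable
  using (Dec; map′; _×-dec_; _⊎-dec_; _→-dec_)
open import Relation.Unary using (Pred; Decidable)
open import Relation.Binary.Core using (Rel)
open import Relation.Binary.Definitions using (DecidableEquality)
open import Relation.Binary.Structures using (IsDecPartialOrder; IsPartialOrder)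
open import Relation.Binary.PropositionalEquality
  using (_≡_; refl; sym; trans; cong; subst; subst₂; isEquivalence)

record FinitePoset : Set₁ where
  infix 4 _≤_
  field
    Carrier           : Set
    _≤_               : Rel Carrier 0ℓ
    isDecPartialOrder : IsDecPartialOrder _≡_ _≤_
    elements          : List Carrier
    enumerates        : ∀ x → x ∈ elements

  open IsDecPartialOrder isDecPartialOrder public using (_≟_; _≤?_)

chain : ℕ → FinitePoset
chain k = record
  { Carrier           = Fin k
  ; _≤_               = Fin._≤_
  ; isDecPartialOrder = record
      { isPartialOrder = Finₚ.≤-isPartialOrder
      ; _≟_            = Finₚ._≟_
      ; _≤?_           = Finₚ._≤?_
      }
  ; elements          = allFin k
  ; enumerates        = ∈-allFin
  }

module _ {s : ℕ} (r : Fin s → ℕ) where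

  -- The pair (i , h) is the element a^i_h.
  KCarrier : Set
  KCarrier = Σ[ i ∈ Fin s ] Fin (r i)

  _≤K_ : Rel KCarrier 0ℓ
  x ≤K y = x ≡ y ⊎ proj₁ x Fin.< proj₁ y

  private
    ≤K-isPartialOrder : IsPartialOrder _≡_ _≤K_
    ≤K-isPartialOrder = record
      { isPreorder = record
        { isEquivalence = isEquivalence
        ; reflexive     = inj₁
        ; trans         = λ where
            (inj₁ refl) q           → q
            (inj₂ p)    (inj₁ refl) → inj₂ p
            (inj₂ p)    (inj₂ q)    → inj₂ (Finₚ.<-trans p q)
        }
      ; antisym = λ where
          (inj₁ p) _        → p
          (inj₂ p) (inj₁ q) → sym q
          (inj₂ p) (inj₂ q) → ⊥-elim (Finₚ.<-asym p q)
      }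

    _≟K_ : DecidableEquality KCarrier
    _≟K_ = Σ-≡-dec Finₚ._≟_ Finₚ._≟_

  K : FinitePoset
  K = record
    { Carrier           = KCarrier
    ; _≤_               = _≤K_
    ; isDecPartialOrder = record
        { isPartialOrder = ≤K-isPartialOrder
        ; _≟_            = _≟K_
        ; _≤?_           = λ x y → (x ≟K y) ⊎-dec (proj₁ x Finₚ.<? proj₁ y)
        }
    ; elements          = concatMap (λ i → map (i ,_) (allFin (r i))) (allFin s)
    ; enumerates        = λ (i , h) →
        ∈-concatMap⁺ _ (lose (∈-allFin i) (∈-map⁺ (i ,_) (∈-allFin h)))
    }

-- A family of sets is a list without repetitions.  To have one list per family, a
-- family in 2^[n] is by convention an element of subfamilies 2^[ n ], i.e. a
-- list whose members come in the order in which 2^[ n ] lists them.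

Family : ℕ → Set
Family n = List (Subset n)

2^[_] : ∀ n → Family n
2^[ zero  ] = [] ∷ []
2^[ suc n ] = map (outside ∷_) 2^[ n ] ++ map (inside ∷_) 2^[ n ]

-- If 𝓕 has no repetitions, each subfamily occurs exactly once.
subfamilies : ∀ {n} → Family n → List (Family n)
subfamilies []      = [] ∷ []
subfamilies (A ∷ 𝓕) = map (A ∷_) (subfamilies 𝓕) ++ subfamilies 𝓕

level : ∀ n → ℕ → Family n
level n k = filter (λ A → ∣ A ∣ ≟ℕ k) 2^[ n ]

IsUnionOfLevels : ∀ {n} → Family n → Set
IsUnionOfLevels {n} 𝓕 =
  Σ[ ks ∈ List ℕ ] (∀ (A : Subset n) → A ∈ 𝓕 ⇔ (∃[ k ] (k ∈ ks × A ∈ level n k)))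

module _ (P : FinitePoset) {n : ℕ} where
  open FinitePoset P

  -- Copies are weak: φ need not reflect the order.
  IsCopyMap : Family n → (Carrier → Subset n) → Set
  IsCopyMap 𝓖 φ =
      Injective _≡_ _≡_ φ
    × (∀ x → φ x ∈ 𝓖)
    × (∀ {A} → A ∈ 𝓖 → ∃[ x ] φ x ≡ A)
    × (∀ {x x′} → x ≤ x′ → φ x ⊆ φ x′)

  IsCopy : Family n → Set
  IsCopy 𝓖 = ∃[ φ ] IsCopyMap 𝓖 φ

  private
    _≟S_ : DecidableEquality (Subset n)
    _≟S_ = Vecₚ.≡-dec Boolₚ._≟_

    open DecMembership _≟S_ using (_∈?_)

    allCarrier? : {Q : Pred Carrier 0ℓ} → Decidable Q → Dec (∀ x → Q x)
    allCarrier? Q? = map′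
      (λ all x → All.lookup all (enumerates x))
      (λ f → All.tabulate (λ {x} _ → f x))
      (All.all? Q? elements)

    anyCarrier? : {Q : Pred Carrier 0ℓ} → Decidable Q → Dec (∃ Q)
    anyCarrier? Q? = map′
      (λ any → let x , _ , q = find any in x , q)
      (λ (x , q) → lose (enumerates x) q)
      (any? Q? elements)

    anyVec? : ∀ {k} {Q : Pred (Vec (Subset n) k) 0ℓ} → Decidable Q → Dec (∃ Q)
    anyVec? {zero}  Q? = map′ ([] ,_) (λ { ([] , q) → q }) (Q? [])
    anyVec? {suc k} Q? = map′
      (λ (A , v , q) → A ∷ v , q)
      (λ { (A ∷ v , q) → A , v , q })
      (anySubset? (λ A → anyVec? (λ v → Q? (A ∷ v))))

    isCopyMap? : ∀ 𝓖 φ → Dec (IsCopyMap 𝓖 φ)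
    isCopyMap? 𝓖 φ =
      map′ (λ f {x} {x′} → f x x′) (λ f x x′ → f {x} {x′})
        (allCarrier? λ x → allCarrier? λ x′ → (φ x ≟S φ x′) →-dec (x ≟ x′))
      ×-dec allCarrier? (λ x → φ x ∈? 𝓖)
      ×-dec map′ (λ all {A} → All.lookup all) (λ f → All.tabulate f)
        (All.all? (λ A → anyCarrier? (λ x → φ x ≟S A)) 𝓖)
      ×-dec map′ (λ f {x} {x′} → f x x′) (λ f x x′ → f {x} {x′})
        (allCarrier? λ x → allCarrier? λ x′ → (x ≤? x′) →-dec (φ x ⊆? φ x′))

    isCopyMap-resp : ∀ {𝓖 φ ψ} → (∀ x → φ x ≡ ψ x) →
                     IsCopyMap 𝓖 φ → IsCopyMap 𝓖 ψ
    isCopyMap-resp {𝓖} φ≗ψ (inj , into , onto , mono) =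
        (λ {x} {y} e → inj (trans (φ≗ψ x) (trans e (sym (φ≗ψ y)))))
      , (λ x → subst (_∈ 𝓖) (φ≗ψ x) (into x))
      , (λ A∈𝓖 → let x , e = onto A∈𝓖 in x , trans (sym (φ≗ψ x)) e)
      , (λ {x} {y} x≤y → subst₂ _⊆_ (φ≗ψ x) (φ≗ψ y) (mono x≤y))

    fromTable : Vec (Subset n) (length elements) → Carrier → Subset n
    fromTable v x = Vec.lookup v (index (enumerates x))

    toTable : (Carrier → Subset n) → Vec (Subset n) (length elements)
    toTable φ = Vec.tabulate (φ ∘ List.lookup elements)

    from∘to : ∀ φ x → φ x ≡ fromTable (toTable φ) x
    from∘to φ x = trans
      (cong φ (Anyₚ.lookup-index (enumerates x)))
      (sym (Vecₚ.lookup∘tabulate _ (index (enumerates x))))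

  isCopy? : Decidable IsCopy
  isCopy? 𝓖 = map′
    (λ (v , p) → fromTable v , p)
    (λ (φ , p) → toTable φ , isCopyMap-resp (from∘to φ) p)
    (anyVec? (λ v → isCopyMap? 𝓖 (fromTable v)))

c : FinitePoset → ∀ {n} → Family n → ℕ
c P 𝓕 = length (filter (isCopy? P) (subfamilies 𝓕))

IsFree : FinitePoset → ∀ {n} → Family n → Set
IsFree P 𝓕 = c P 𝓕 ≡ 0

-- The default value 0 of max matters only if no family is P-free, which
-- requires P to be empty.
La : ℕ → FinitePoset → FinitePoset → ℕ
La n P Q = max 0 (map (c Q) (filter (λ 𝓕 → c P 𝓕 ≟ℕ 0) (subfamilies 2^[ n ])))

-- Let 𝓕 be P_{s+1}-free, and let 𝓕_i consist of those sets of 𝓕 above which the longest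
-- chain in 𝓕 has exactly s - i elements (1 ≤ i ≤ s).  Each 𝓕_i is an antichain, and the i-th
-- level of a copy of K_{r_1,…,r_s} in 𝓕 lies in 𝓕_i.  Count the copies from the bottom up,
-- with X the last singleton level chosen (initially X = ∅).  If r_i = 1, sum over the set
-- A ∈ 𝓕_i above X.  If r_i ≥ 2 and i < s, sum over the set A ∈ 𝓕_{i+1} above X that forms the
-- next level, again a singleton; level i is then an r_i-subset of an antichain in [X , A] (in
-- [X , ⊤] if i = s).  The weights in these sums depend on ∣A∣ only, so by the LYM inequality in
-- intervals each sum is at most its value for a suitable full level in place of 𝓕_i.  Hence
-- c(K, 𝓕) is at most a maximum of products of binomial coefficients, which is attained by a
-- union of s full levels, a P_{s+1}-free family (by the empty family, if the maximum is 0).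
-- The argument works for every n.

module Submission where

open import Defs
import Data.Bool.Properties as Boolₚ
open import Data.Empty using (⊥; ⊥-elim)
open import Data.Fin.Base as Fin using (Fin; zero; suc; toℕ)
import Data.Fin.Properties as Finₚ
open import Data.Fin.Subset using (Subset; inside; outside; _⊆_; ∣_∣; _-_; ⊤)
  renaming (_∈_ to _∈ˢ_; _∉_ to _∉ˢ_; ⊥ to ∅)
open import Data.Fin.Subset.Properties
  using (_⊆?_; _∈?_; p⊆q⇒∣p∣≤∣q∣; drop-∷-⊆; out⊆; s⊆s; p─⊥≡p; x∈p∧x≢y⇒x∈p-y; drop-there; ⊆⊤;
        ∉⊥; ∣⊤∣≡n; ∣⊥∣≡0; ∣p∣≤n)
open import Data.List.Base
  using (List; []; _∷_; _++_; map; filter; length; concatMap; lookup; allFin; upTo; tabulate)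
open import Data.List.Extrema.Nat using (max; xs≤max; max≤v⁺; argmax-sel)
import Data.List.Membership.DecPropositional as DecMembership
open import Data.List.Membership.Propositional using (_∈_; find; lose)
open import Data.List.Membership.Propositional.Properties
  using (∈-map⁺; ∈-map⁻; ∈-++⁺ˡ; ∈-++⁺ʳ; ∈-++⁻; ∈-lookup; ∈-concatMap⁺; ∈-concatMap⁻;
        ∈-filter⁺; ∈-filter⁻; ∈-upTo⁺; ∈-upTo⁻; ∈-tabulate⁺; ∈-tabulate⁻)
open import Data.List.Properties
  using (length-++; length-map; length-tabulate; filter-++; filter-≐; filter-none;
        filter-all; ∷-injective; map-tabulate)
open import Data.List.Relation.Binary.Sublist.Propositional using ([]; _∷_; _∷ʳ_; ⊆-trans; from∈)
  renaming (_⊆_ to _⊑_; lookup to ⊑-lookup)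
import Data.List.Relation.Binary.Sublist.Propositional.Properties as Sublistₚ
import Data.List.Relation.Unary.All as All
open import Data.List.Relation.Unary.AllPairs using ([]; _∷_)
open import Data.List.Relation.Unary.Any as Any using (Any; any?; here; there; index)
open import Data.List.Relation.Unary.Any.Properties using (lookup-index)
open import Data.List.Relation.Unary.Unique.Propositional using (Unique)
import Data.List.Relation.Unary.Unique.Propositional.Properties as Uniqueₚ
open import Data.Nat.Base hiding (∣_-_∣)
open import Data.Nat.Combinatorics
  using (_C_; nCk+nC[k+1]≡[n+1]C[k+1]; nCk≡n!/k![n-k]!; k![n∸k]!∣n!; k>n⇒nCk≡0)
open import Data.Nat.DivMod using (m/n*n≡m)
open import Data.Nat.ListAction using (sum)
open import Data.Nat.Properties
open import Algebra.Properties.CommutativeSemigroup +-commutativeSemigroup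
  using (interchange; x∙yz≈y∙xz)
import Algebra.Properties.CommutativeSemigroup *-commutativeSemigroup as *-CS
open import Data.Product.Base using (_×_; ∃-syntax; Σ-syntax; _,_; proj₁; proj₂)
open import Data.Product.Properties.WithK using (,-injectiveʳ)
open import Data.Sum.Base using (_⊎_; inj₁; inj₂; [_,_]′)
open import Data.Unit.Base using (tt) renaming (⊤ to Unit)
open import Data.Vec.Base as Vec using (Vec; []; _∷_; here; there)
import Data.Vec.Functional as Vector
import Data.Vec.Properties as Vecₚ
open import Function.Base using (_∘_; id)
open import Function.Bundles using (mk⇔)
open import Function.Definitions using (Injective)
open import Level using (Level; 0ℓ)
open import Relation.Binary.Definitions using (DecidableEquality; tri<; tri≈; tri>)
open import Relation.Binary.PropositionalEquality
open import Relation.Nullary.Decidable using (Dec; yes; no; _×-dec_; ¬?; decidable-stable)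
open import Relation.Nullary.Negation using (¬_)
open import Relation.Unary using (Decidable; Pred)

private
  variable
    a p q : Level
    A B : Set a
    n s : ℕ
    r : Fin s → ℕ

-- Lists without repetitions

Unique⇒lookup-injective : {xs : List A} → Unique xs → ∀ {i j} →
                          lookup xs i ≡ lookup xs j → i ≡ j
Unique⇒lookup-injective (x∉ ∷ u) {zero}  {zero}  e = refl
Unique⇒lookup-injective (x∉ ∷ u) {zero}  {suc j} e =
  ⊥-elim (All.lookup x∉ (∈-lookup j) e)
Unique⇒lookup-injective (x∉ ∷ u) {suc i} {zero}  e =
  ⊥-elim (All.lookup x∉ (∈-lookup i) (sym e))
Unique⇒lookup-injective (x∉ ∷ u) {suc i} {suc j} e =
  cong suc (Unique⇒lookup-injective u e)

-- Positions in `xs` are sent to positions in `ys`. Injectivity of `f` is asked on the members of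
-- `xs` only, which is all that is shown for `slices` and `union` when copies are compared with
-- tuples.
length-≤-by-injection : {xs : List A} {ys : List B} (f : A → B) → Unique xs →
  (∀ {x} → x ∈ xs → f x ∈ ys) →
  (∀ {x y} → x ∈ xs → y ∈ xs → f x ≡ f y → x ≡ y) →
  length xs ≤ length ys
length-≤-by-injection {xs = xs} {ys} f u into inj =
  Finₚ.injective⇒≤ {f = λ i → index (into (∈-lookup {xs = xs} i))} λ {i} {j} e →
    Unique⇒lookup-injective u (inj (∈-lookup i) (∈-lookup j)
      (trans (lookup-index (into (∈-lookup i)))
        (trans (cong (lookup ys) e) (sym (lookup-index (into (∈-lookup j)))))))

concatMap-unique : {f : A → List B} {xs : List A} → Unique xs →
  (∀ {x} → x ∈ xs → Unique (f x)) →
  (∀ {x y z} → x ∈ xs → y ∈ xs → z ∈ f x → z ∈ f y → x ≡ y) →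
  Unique (concatMap f xs)
concatMap-unique {xs = []} [] uf disj = []
concatMap-unique {f = f} {xs = x ∷ xs} (x∉ ∷ u) uf disj =
  Uniqueₚ.++⁺ (uf (here refl))
    (concatMap-unique u (λ m → uf (there m)) (λ m m′ → disj (there m) (there m′)))
    λ (z∈fx , z∈r) → let y , y∈xs , z∈fy = find (∈-concatMap⁻ f {xs = xs} z∈r) in
      All.lookup x∉ y∈xs (disj (here refl) (there y∈xs) z∈fx z∈fy)

-- The order of a sublist is dictated by `zs`, so its members determine it. This turns mutual
-- inclusion of families into equality of the lists that represent them.
sublists-≡ : {xs ys zs : List A} → Unique zs → xs ⊑ zs → ys ⊑ zs →
  (∀ {x} → x ∈ xs → x ∈ ys) → (∀ {x} → x ∈ ys → x ∈ xs) → xs ≡ ys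
sublists-≡ u [] [] f g = refl
sublists-≡ (_ ∷ u) (y ∷ʳ p) (.y ∷ʳ q) f g = sublists-≡ u p q f g
sublists-≡ (y∉ ∷ u) (y ∷ʳ p) (refl ∷ q) f g =
  ⊥-elim (All.lookup y∉ (⊑-lookup p (g (here refl))) refl)
sublists-≡ (y∉ ∷ u) (refl ∷ p) (y ∷ʳ q) f g =
  ⊥-elim (All.lookup y∉ (⊑-lookup q (f (here refl))) refl)
sublists-≡ {xs = y ∷ xs} {ys = _ ∷ ys} (y∉ ∷ u) (refl ∷ p) (refl ∷ q) f g =
  cong (y ∷_) (sublists-≡ u p q (drop p f) (drop q g))
  where
  drop : ∀ {us vs} → us ⊑ _ → (∀ {x} → x ∈ y ∷ us → x ∈ y ∷ vs) → ∀ {x} → x ∈ us → x ∈ vs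
  drop r h m with h (there m)
  ... | here refl = ⊥-elim (All.lookup y∉ (⊑-lookup r m) refl)
  ... | there m′  = m′

∈-singletons-≡ : {xs : List A} {y : A} → Unique xs → (∀ {x} → x ∈ xs → x ≡ y) →
                 xs ≡ [] ⊎ xs ≡ y ∷ []
∈-singletons-≡ {xs = []} u e = inj₁ refl
∈-singletons-≡ {xs = x ∷ []} u e = inj₂ (cong (_∷ []) (e (here refl)))
∈-singletons-≡ {xs = x ∷ y ∷ xs} ((x≢y All.∷ _) ∷ _) e =
  ⊥-elim (x≢y (trans (e (here refl)) (sym (e (there (here refl))))))

length-filter-map : {P : Pred B p} (P? : Decidable P) (f : A → B) (xs : List A) →
  length (filter P? (map f xs)) ≡ length (filter (P? ∘ f) xs)
length-filter-map P? f [] = refl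
length-filter-map P? f (x ∷ xs) with P? (f x)
... | yes _ = cong suc (length-filter-map P? f xs)
... | no  _ = length-filter-map P? f xs

-- Finite sums and double counting

∑ : List A → (A → ℕ) → ℕ
∑ xs f = sum (map f xs)

∑-mono : (xs : List A) {f g : A → ℕ} → (∀ {x} → x ∈ xs → f x ≤ g x) → ∑ xs f ≤ ∑ xs g
∑-mono []       h = z≤n
∑-mono (x ∷ xs) h = +-mono-≤ (h (here refl)) (∑-mono xs (λ m → h (there m)))

∑-cong : (xs : List A) {f g : A → ℕ} → (∀ {x} → x ∈ xs → f x ≡ g x) → ∑ xs f ≡ ∑ xs g
∑-cong []       h = refl
∑-cong (x ∷ xs) h = cong₂ _+_ (h (here refl)) (∑-cong xs (λ m → h (there m)))

∑-const : (xs : List A) (k : ℕ) → ∑ xs (λ _ → k) ≡ length xs * k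
∑-const []       k = refl
∑-const (x ∷ xs) k = cong (k +_) (∑-const xs k)

∑-*-distribʳ : (xs : List A) (f : A → ℕ) (k : ℕ) → ∑ xs f * k ≡ ∑ xs (λ x → f x * k)
∑-*-distribʳ []       f k = refl
∑-*-distribʳ (x ∷ xs) f k =
  trans (*-distribʳ-+ k (f x) _) (cong (f x * k +_) (∑-*-distribʳ xs f k))

length-concatMap : (f : A → List B) (xs : List A) →
                   length (concatMap f xs) ≡ ∑ xs (length ∘ f)
length-concatMap f []       = refl
length-concatMap f (x ∷ xs) =
  trans (length-++ (f x)) (cong (length (f x) +_) (length-concatMap f xs))

-- Each side adds `w y` once for every related pair `(x , y)`, grouped by `x` on the left and by `y`
-- on the right.
∑-double-count : {R : A → B → Set p} (R? : ∀ x y → Dec (R x y))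
  (xs : List A) (ys : List B) (w : B → ℕ) →
  ∑ xs (λ x → ∑ (filter (R? x) ys) w) ≡
  ∑ ys (λ y → length (filter (λ x → R? x y) xs) * w y)
∑-double-count R? []       ys w = sym (trans (∑-const ys 0) (*-zeroʳ (length ys)))
∑-double-count R? (x ∷ xs) ys w = begin
  ∑ (filter (R? x) ys) w + ∑ xs (λ x → ∑ (filter (R? x) ys) w)
    ≡⟨ cong (_ +_) (∑-double-count R? xs ys w) ⟩
  ∑ (filter (R? x) ys) w + ∑ ys (λ y → length (filter (λ x → R? x y) xs) * w y)
    ≡⟨ add ys ⟩
  ∑ ys (λ y → length (filter (λ x → R? x y) (x ∷ xs)) * w y) ∎
  where
  open ≡-Reasoning
  deg : _ → ℕ
  deg y = length (filter (λ x → R? x y) xs) * w y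
  add : ∀ ys → ∑ (filter (R? x) ys) w + ∑ ys deg ≡
               ∑ ys (λ y → length (filter (λ x → R? x y) (x ∷ xs)) * w y)
  add [] = refl
  add (y ∷ ys) with R? x y
  ... | yes _ = trans (interchange (w y) _ (deg y) _) (cong (w y + deg y +_) (add ys))
  ... | no  _ = trans (x∙yz≈y∙xz (∑ (filter (R? x) ys) w) (deg y) _) (cong (deg y +_) (add ys))

-- Subfamilies and the number of those of a given size

_≟ˢ_ : DecidableEquality (Subset n)
_≟ˢ_ = Vecₚ.≡-dec Boolₚ._≟_

private
  open module SubsetMembership {n} = DecMembership (_≟ˢ_ {n}) using () renaming (_∈?_ to _∈ᶠ?_)
  open module SizeMembership = DecMembership _≟_ using () renaming (_∈?_ to _∈ℕ?_)

⊑⇒∈-subfamilies : {𝓖 𝓕 : Family n} → 𝓖 ⊑ 𝓕 → 𝓖 ∈ subfamilies 𝓕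
⊑⇒∈-subfamilies []         = here refl
⊑⇒∈-subfamilies (A ∷ʳ q)   = ∈-++⁺ʳ _ (⊑⇒∈-subfamilies q)
⊑⇒∈-subfamilies (refl ∷ q) = ∈-++⁺ˡ (∈-map⁺ _ (⊑⇒∈-subfamilies q))

∈-subfamilies⇒⊑ : {𝓖 : Family n} (𝓕 : Family n) → 𝓖 ∈ subfamilies 𝓕 → 𝓖 ⊑ 𝓕
∈-subfamilies⇒⊑ []      (here refl) = []
∈-subfamilies⇒⊑ (A ∷ 𝓕) m with ∈-++⁻ (map (A ∷_) (subfamilies 𝓕)) m
... | inj₂ m′ = A ∷ʳ ∈-subfamilies⇒⊑ 𝓕 m′
... | inj₁ m′ with ∈-map⁻ (A ∷_) m′
...   | _ , m″ , refl = refl ∷ ∈-subfamilies⇒⊑ 𝓕 m″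

subfamilies-unique : {𝓕 : Family n} → Unique 𝓕 → Unique (subfamilies 𝓕)
subfamilies-unique [] = All.[] ∷ []
subfamilies-unique {𝓕 = A ∷ 𝓕} (A∉ ∷ u) = Uniqueₚ.++⁺
  (Uniqueₚ.map⁺ (proj₂ ∘ ∷-injective) (subfamilies-unique u))
  (subfamilies-unique u)
  λ (m , m′) → case m m′
  where
  case : ∀ {𝓖} → 𝓖 ∈ map (A ∷_) (subfamilies 𝓕) → 𝓖 ∈ subfamilies 𝓕 → ⊥
  case m m′ with ∈-map⁻ (A ∷_) m
  ... | _ , _ , refl = All.lookup A∉ (⊑-lookup (∈-subfamilies⇒⊑ 𝓕 m′) (here refl)) refl

choose : ℕ → Family n → List (Family n)
choose r 𝓕 = filter (λ 𝓖 → length 𝓖 ≟ r) (subfamilies 𝓕)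

-- Pascal's rule: a subfamily of `A ∷ 𝓕` with r members either contains the head `A` and r - 1 sets
-- from `𝓕`, or is a subfamily of `𝓕`.
length-choose : ∀ r (𝓕 : Family n) → length (choose r 𝓕) ≡ length 𝓕 C r
length-choose zero    [] = refl
length-choose (suc r) [] = refl
length-choose r (A ∷ 𝓕) = begin
  length (choose r (A ∷ 𝓕))
    ≡⟨ cong length (filter-++ (λ 𝓖 → length 𝓖 ≟ r) (map (A ∷_) (subfamilies 𝓕)) _) ⟩
  length (filter (λ 𝓖 → length 𝓖 ≟ r) (map (A ∷_) (subfamilies 𝓕)) ++ choose r 𝓕)
    ≡⟨ length-++ (filter (λ 𝓖 → length 𝓖 ≟ r) (map (A ∷_) (subfamilies 𝓕))) ⟩
  length (filter (λ 𝓖 → length 𝓖 ≟ r) (map (A ∷_) (subfamilies 𝓕))) + length (choose r 𝓕)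
    ≡⟨ cong₂ _+_ (length-filter-map (λ 𝓖 → length 𝓖 ≟ r) (A ∷_) (subfamilies 𝓕)) (length-choose r 𝓕) ⟩
  length (filter (λ 𝓖 → suc (length 𝓖) ≟ r) (subfamilies 𝓕)) + length 𝓕 C r
    ≡⟨ pascal r ⟩
  suc (length 𝓕) C r ∎
  where
  open ≡-Reasoning
  pascal : ∀ r → length (filter (λ 𝓖 → suc (length 𝓖) ≟ r) (subfamilies 𝓕)) + length 𝓕 C r
                 ≡ suc (length 𝓕) C r
  pascal zero = cong (λ z → length z + 1)
    (filter-none (λ 𝓖 → suc (length 𝓖) ≟ 0) {subfamilies 𝓕} (All.tabulate λ _ ()))
  pascal (suc r) = begin
    length (filter (λ 𝓖 → suc (length 𝓖) ≟ suc r) (subfamilies 𝓕)) + length 𝓕 C suc r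
      ≡⟨ cong (λ z → length z + length 𝓕 C suc r)
           (filter-≐ _ (λ 𝓖 → length 𝓖 ≟ r) (suc-injective , cong suc) (subfamilies 𝓕)) ⟩
    length (choose r 𝓕) + length 𝓕 C suc r
      ≡⟨ cong (_+ length 𝓕 C suc r) (length-choose r 𝓕) ⟩
    length 𝓕 C r + length 𝓕 C suc r
      ≡⟨ nCk+nC[k+1]≡[n+1]C[k+1] (length 𝓕) r ⟩
    suc (length 𝓕) C suc r ∎

C-monoˡ-≤ : ∀ k {m n} → m ≤ n → m C k ≤ n C k
C-monoˡ-≤ k {m} {n} m≤n = go (≤⇒≤′ m≤n)
  where
  step : ∀ k n → n C k ≤ suc n C k
  step zero    n = ≤-refl
  step (suc k) n = subst (n C suc k ≤_) (nCk+nC[k+1]≡[n+1]C[k+1] n k) (m≤n+m _ _)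
  go : ∀ {n} → m ≤′ n → m C k ≤ n C k
  go (≤′-reflexive refl) = ≤-refl
  go (≤′-step q)         = ≤-trans (go q) (step k _)

-- The power set and strict inclusion

2^-unique : ∀ n → Unique 2^[ n ]
2^-unique zero    = All.[] ∷ []
2^-unique (suc n) = Uniqueₚ.++⁺
  (Uniqueₚ.map⁺ Vecₚ.∷-injectiveʳ (2^-unique n))
  (Uniqueₚ.map⁺ Vecₚ.∷-injectiveʳ (2^-unique n))
  λ (m , m′) → case m m′
  where
  case : ∀ {A} → A ∈ map (outside ∷_) 2^[ n ] → A ∈ map (inside ∷_) 2^[ n ] → ⊥
  case m m′ with ∈-map⁻ _ m | ∈-map⁻ _ m′
  ... | _ , _ , refl | _ , _ , ()

∈-2^ : (A : Subset n) → A ∈ 2^[ n ]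
∈-2^ [] = here refl
∈-2^ (outside ∷ A) = ∈-++⁺ˡ (∈-map⁺ _ (∈-2^ A))
∈-2^ (inside  ∷ A) = ∈-++⁺ʳ _ (∈-map⁺ _ (∈-2^ A))

filter-filter : {P : Pred A p} {Q : Pred A q} (P? : Decidable P) (Q? : Decidable Q) (xs : List A) →
  filter P? (filter Q? xs) ≡ filter (λ x → P? x ×-dec Q? x) xs
filter-filter P? Q? [] = refl
filter-filter P? Q? (x ∷ xs) with Q? x | P? x in eq
... | yes _ | yes _ rewrite eq = cong (x ∷_) (filter-filter P? Q? xs)
... | yes _ | no  _ rewrite eq = filter-filter P? Q? xs
... | no  _ | yes _ = filter-filter P? Q? xs
... | no  _ | no  _ = filter-filter P? Q? xs

⊆∧≢⇒∣∣< : {X Y : Subset n} → X ⊆ Y → ¬ X ≡ Y → ∣ X ∣ < ∣ Y ∣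
⊆∧≢⇒∣∣< {X = []}          {[]}          X⊆Y X≢Y = ⊥-elim (X≢Y refl)
⊆∧≢⇒∣∣< {X = outside ∷ X} {outside ∷ Y} X⊆Y X≢Y = ⊆∧≢⇒∣∣< (drop-∷-⊆ X⊆Y) (X≢Y ∘ cong (outside ∷_))
⊆∧≢⇒∣∣< {X = outside ∷ X} {inside  ∷ Y} X⊆Y X≢Y = s≤s (p⊆q⇒∣p∣≤∣q∣ (drop-∷-⊆ X⊆Y))
⊆∧≢⇒∣∣< {X = inside  ∷ X} {outside ∷ Y} X⊆Y X≢Y with () ← X⊆Y here
⊆∧≢⇒∣∣< {X = inside  ∷ X} {inside  ∷ Y} X⊆Y X≢Y = s≤s (⊆∧≢⇒∣∣< (drop-∷-⊆ X⊆Y) (X≢Y ∘ cong (inside ∷_)))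

∣p∣≡1+∣p-i∣ : {i : Fin n} {Y : Subset n} → i ∈ˢ Y → ∣ Y ∣ ≡ suc ∣ Y - i ∣
∣p∣≡1+∣p-i∣ {Y = inside ∷ Y}  here        = cong (suc ∘ ∣_∣) (sym (p─⊥≡p Y))
∣p∣≡1+∣p-i∣ {Y = inside ∷ Y}  (there i∈Y) = cong suc (∣p∣≡1+∣p-i∣ i∈Y)
∣p∣≡1+∣p-i∣ {Y = outside ∷ Y} (there i∈Y) = ∣p∣≡1+∣p-i∣ i∈Y

-- The LYM inequality in an interval

gap? : (X Y : Subset n) → Decidable (λ i → i ∈ˢ Y × i ∉ˢ X)
gap? X Y i = (i ∈? Y) ×-dec ¬? (i ∈? X)

gap : Subset n → Subset n → List (Fin n)
gap {n} X Y = filter (gap? X Y) (allFin n)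

length-gap : {X Y : Subset n} → X ⊆ Y → length (gap X Y) + ∣ X ∣ ≡ ∣ Y ∣
length-gap {X = []} {[]} X⊆Y = refl
length-gap {n = suc n} {X = x ∷ X} {y ∷ Y} X⊆Y = go x y X⊆Y
  where
  tail-≡ : ∀ x y → length (filter (gap? (x ∷ X) (y ∷ Y)) (tabulate suc)) ≡ length (gap X Y)
  tail-≡ x y = begin
    length (filter (gap? (x ∷ X) (y ∷ Y)) (tabulate suc))
      ≡⟨ cong (length ∘ filter (gap? (x ∷ X) (y ∷ Y))) (map-tabulate id suc) ⟨
    length (filter (gap? (x ∷ X) (y ∷ Y)) (map suc (allFin n)))
      ≡⟨ length-filter-map (gap? (x ∷ X) (y ∷ Y)) suc (allFin n) ⟩
    length (filter (gap? (x ∷ X) (y ∷ Y) ∘ suc) (allFin n))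
      ≡⟨ cong length (filter-≐ _ (gap? X Y)
           ((λ (p , q) → drop-there p , q ∘ there) , (λ (p , q) → there p , q ∘ drop-there)) (allFin n)) ⟩
    length (gap X Y) ∎
    where open ≡-Reasoning
  IH : x ∷ X ⊆ y ∷ Y → length (gap X Y) + ∣ X ∣ ≡ ∣ Y ∣
  IH h = length-gap (drop-∷-⊆ h)
  go : ∀ x y → x ∷ X ⊆ y ∷ Y → length (gap (x ∷ X) (y ∷ Y)) + ∣ x ∷ X ∣ ≡ ∣ y ∷ Y ∣
  go outside outside h = trans (cong (_+ ∣ X ∣) (tail-≡ outside outside)) (IH X⊆Y)
  go outside inside  h = cong suc (trans (cong (_+ ∣ X ∣) (tail-≡ outside inside)) (IH X⊆Y))
  go inside  outside h with () ← h here
  go inside  inside  h = trans (+-suc _ _) (cong suc (trans (cong (_+ ∣ X ∣) (tail-≡ inside inside)) (IH X⊆Y)))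

Antichain : Family n → Set
Antichain 𝓐 = ∀ {A B} → A ∈ 𝓐 → B ∈ 𝓐 → A ⊆ B → A ≡ B


x*yz≡y*xz : ∀ x y z → x * (y * z) ≡ y * (x * z)
x*yz≡y*xz = *-CS.x∙yz≈y∙xz

-- Double counting the pairs (i , A) with i ∈ Y ∖ A reduces [X , Y] to the intervals [X , Y - i].
lym : ∀ d {X Y : Subset n} {𝓐} → X ⊆ Y → ∣ Y ∣ ≡ d + ∣ X ∣ → Unique 𝓐 → Antichain 𝓐 →
  (∀ {A} → A ∈ 𝓐 → X ⊆ A × A ⊆ Y) →
  ∑ 𝓐 (λ A → (∣ A ∣ ∸ ∣ X ∣) ! * (∣ Y ∣ ∸ ∣ A ∣) !) ≤ d !
-- If `Y` is a member, the antichain is `Y` alone and equality holds. Otherwise every member lies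
-- strictly below `Y`, so `(∣ Y ∣ ∸ ∣ A ∣) !` has a factor to split off in the induction: the number
-- of `i` in `Y` outside `A`.
lym {n} d {X} {Y} {𝓐} X⊆Y eq u anti bd with Y ∈ᶠ? 𝓐
... | yes Y∈𝓐 with ∈-singletons-≡ u (λ A∈𝓐 → anti A∈𝓐 Y∈𝓐 (proj₂ (bd A∈𝓐)))
...   | inj₁ refl = z≤n
...   | inj₂ refl = ≤-reflexive (begin
  (∣ Y ∣ ∸ ∣ X ∣) ! * (∣ Y ∣ ∸ ∣ Y ∣) ! + 0 ≡⟨ +-identityʳ _ ⟩
  (∣ Y ∣ ∸ ∣ X ∣) ! * (∣ Y ∣ ∸ ∣ Y ∣) !
    ≡⟨ cong₂ (λ u v → u ! * v !) (trans (cong (_∸ ∣ X ∣) eq) (m+n∸n≡m d ∣ X ∣)) (n∸n≡0 ∣ Y ∣) ⟩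
  d ! * 1 ≡⟨ *-identityʳ _ ⟩
  d ! ∎)
  where open ≡-Reasoning
lym zero {𝓐 = []} X⊆Y eq u anti bd | no Y∉𝓐 = z≤n
lym zero {X} {Y} {𝓐 = A ∷ 𝓐} X⊆Y eq u anti bd | no Y∉𝓐 = ⊥-elim (<-irrefl refl (begin-strict
  ∣ A ∣ <⟨ ⊆∧≢⇒∣∣< (proj₂ (bd (here refl))) (λ { refl → Y∉𝓐 (here refl) }) ⟩
  ∣ Y ∣ ≡⟨ eq ⟩
  ∣ X ∣ ≤⟨ p⊆q⇒∣p∣≤∣q∣ (proj₁ (bd (here refl))) ⟩
  ∣ A ∣ ∎))
  where open ≤-Reasoning
lym {n} (suc d) {X} {Y} {𝓐} X⊆Y eq u anti bd | no Y∉𝓐 = begin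
  ∑ 𝓐 (λ A → (∣ A ∣ ∸ ∣ X ∣) ! * (∣ Y ∣ ∸ ∣ A ∣) !)
    ≡⟨ ∑-cong 𝓐 split ⟩
  ∑ 𝓐 (λ A → length (filter (λ i → ¬? (i ∈? A)) (gap X Y)) * w A)
    ≡⟨ ∑-double-count (λ i A → ¬? (i ∈? A)) (gap X Y) 𝓐 w ⟨
  ∑ (gap X Y) (λ i → ∑ (filter (λ A → ¬? (i ∈? A)) 𝓐) w)
    ≤⟨ ∑-mono (gap X Y) step ⟩
  ∑ (gap X Y) (λ _ → d !)
    ≡⟨ ∑-const (gap X Y) (d !) ⟩
  length (gap X Y) * d !
    ≤⟨ *-monoˡ-≤ (d !) gap≤ ⟩
  suc d * d ! ∎
  where
  open ≤-Reasoning
  -- The weight of `A` in every interval `[X , Y - i]` at once: `∣ Y - i ∣` is `d + ∣ X ∣` for each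
  -- `i`.
  w : Subset n → ℕ
  w A = (∣ A ∣ ∸ ∣ X ∣) ! * (d + ∣ X ∣ ∸ ∣ A ∣) !

  gap≤ : length (gap X Y) ≤ suc d
  gap≤ = ≤-reflexive (+-cancelʳ-≡ ∣ X ∣ _ _ (trans (length-gap X⊆Y) eq))

  split : ∀ {A} → A ∈ 𝓐 → (∣ A ∣ ∸ ∣ X ∣) ! * (∣ Y ∣ ∸ ∣ A ∣) ! ≡
                          length (filter (λ i → ¬? (i ∈? A)) (gap X Y)) * w A
  split {A} A∈𝓐 = begin-equality
    (∣ A ∣ ∸ ∣ X ∣) ! * (∣ Y ∣ ∸ ∣ A ∣) !
      ≡⟨ cong (λ k → (∣ A ∣ ∸ ∣ X ∣) ! * k !) y∸a ⟩
    (∣ A ∣ ∸ ∣ X ∣) ! * (suc (d + ∣ X ∣ ∸ ∣ A ∣) * (d + ∣ X ∣ ∸ ∣ A ∣) !)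
      ≡⟨ x*yz≡y*xz ((∣ A ∣ ∸ ∣ X ∣) !) (suc (d + ∣ X ∣ ∸ ∣ A ∣)) _ ⟩
    suc (d + ∣ X ∣ ∸ ∣ A ∣) * w A
      ≡⟨ cong (_* w A) (trans (sym y∸a) (trans (cong (_∸ ∣ A ∣) (sym (length-gap A⊆Y))) (m+n∸n≡m _ ∣ A ∣))) ⟩
    length (gap A Y) * w A
      ≡⟨ cong (λ js → length js * w A) (filter-≐ (gap? A Y) _
           ((λ (p , q) → q , p , q ∘ X⊆A) , (λ (q , p , _) → p , q)) (allFin n)) ⟩
    length (filter (λ i → ¬? (i ∈? A) ×-dec gap? X Y i) (allFin n)) * w A
      ≡⟨ cong (λ js → length js * w A) (filter-filter (λ i → ¬? (i ∈? A)) (gap? X Y) (allFin n)) ⟨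
    length (filter (λ i → ¬? (i ∈? A)) (gap X Y)) * w A ∎
    where
    X⊆A : X ⊆ A
    X⊆A = proj₁ (bd A∈𝓐)
    A⊆Y : A ⊆ Y
    A⊆Y = proj₂ (bd A∈𝓐)
    y∸a : ∣ Y ∣ ∸ ∣ A ∣ ≡ suc (d + ∣ X ∣ ∸ ∣ A ∣)
    y∸a = trans (cong (_∸ ∣ A ∣) eq) (+-∸-assoc 1 (s≤s⁻¹ (subst (∣ A ∣ <_) eq
            (⊆∧≢⇒∣∣< A⊆Y λ { refl → Y∉𝓐 A∈𝓐 }))))

  step : ∀ {i} → i ∈ gap X Y → ∑ (filter (λ A → ¬? (i ∈? A)) 𝓐) w ≤ d !
  step {i} i∈gap with ∈-filter⁻ (gap? X Y) {xs = allFin n} i∈gap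
  ... | _ , i∈Y , i∉X = subst
    (λ y → ∑ (filter (λ A → ¬? (i ∈? A)) 𝓐) (λ A → (∣ A ∣ ∸ ∣ X ∣) ! * (y ∸ ∣ A ∣) !) ≤ d !) eq′
    (lym d (avoid X⊆Y i∉X) eq′ (Uniqueₚ.filter⁺ (λ A → ¬? (i ∈? A)) u)
      (λ A∈ B∈ → anti (proj₁ (mem A∈)) (proj₁ (mem B∈)))
      (λ A∈ → proj₁ (bd (proj₁ (mem A∈))) , avoid (proj₂ (bd (proj₁ (mem A∈)))) (proj₂ (mem A∈))))
    where
    mem : ∀ {A} → A ∈ filter (λ A → ¬? (i ∈? A)) 𝓐 → A ∈ 𝓐 × i ∉ˢ A
    mem = ∈-filter⁻ (λ A → ¬? (i ∈? A)) {xs = 𝓐}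
    eq′ : ∣ Y - i ∣ ≡ d + ∣ X ∣
    eq′ = suc-injective (trans (sym (∣p∣≡1+∣p-i∣ i∈Y)) eq)
    avoid : ∀ {A} → A ⊆ Y → i ∉ˢ A → A ⊆ Y - i
    avoid A⊆Y i∉A x∈A = x∈p∧x≢y⇒x∈p-y (A⊆Y x∈A) λ { refl → i∉A x∈A }

k≤n⇒nCk*k!*[n∸k]!≡n! : ∀ {m k} → k ≤ m → (m C k) * (k ! * (m ∸ k) !) ≡ m !
k≤n⇒nCk*k!*[n∸k]!≡n! {m} {k} k≤m =
  trans (cong (_* (k ! * (m ∸ k) !)) (nCk≡n!/k![n-k]! k≤m)) (m/n*n≡m (k![n∸k]!∣n! k≤m))
  where instance _ = k !* (m ∸ k) !≢0

-- Multiply by `m !`. As the binomial coefficient is `m !` divided by the weight of `A` in `lym`,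
-- the last hypothesis says that `f ∣ A ∣ * m !` is at most this weight times `b`; the weights add
-- up to at most `m !`, which cancels. The left side of that hypothesis is the value of the sum for
-- the full level of size `∣ A ∣` in the interval.
weighted-lym : {X Y : Subset n} {𝓐 : Family n} (f : ℕ → ℕ) (b : ℕ) → X ⊆ Y →
  Unique 𝓐 → Antichain 𝓐 →
  (∀ {A} → A ∈ 𝓐 → X ⊆ A × A ⊆ Y) →
  (∀ {A} → A ∈ 𝓐 → ((∣ Y ∣ ∸ ∣ X ∣) C (∣ A ∣ ∸ ∣ X ∣)) * f ∣ A ∣ ≤ b) →
  ∑ 𝓐 (f ∘ ∣_∣) ≤ b
weighted-lym {X = X} {Y} {𝓐} f b X⊆Y u anti bd le = *-cancelʳ-≤ _ _ (m !) ⦃ m !≢0 ⦄ (begin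
  ∑ 𝓐 (f ∘ ∣_∣) * m !              ≡⟨ ∑-*-distribʳ 𝓐 (f ∘ ∣_∣) (m !) ⟩
  ∑ 𝓐 (λ A → f ∣ A ∣ * m !)         ≤⟨ ∑-mono 𝓐 pointwise ⟩
  ∑ 𝓐 (λ A → w A * b)              ≡⟨ ∑-*-distribʳ 𝓐 w b ⟨
  ∑ 𝓐 w * b                        ≤⟨ *-monoˡ-≤ b (lym m X⊆Y (sym (m∸n+n≡m x≤y)) u anti bd) ⟩
  m ! * b                          ≡⟨ *-comm (m !) b ⟩
  b * m ! ∎)
  where
  open ≤-Reasoning
  m = ∣ Y ∣ ∸ ∣ X ∣
  x≤y = p⊆q⇒∣p∣≤∣q∣ X⊆Y
  w = λ A → (∣ A ∣ ∸ ∣ X ∣) ! * (∣ Y ∣ ∸ ∣ A ∣) !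
  pointwise : ∀ {A} → A ∈ 𝓐 → f ∣ A ∣ * m ! ≤ w A * b
  pointwise {A} A∈𝓐 = begin
    f ∣ A ∣ * m !
      ≡⟨ cong (f ∣ A ∣ *_) (k≤n⇒nCk*k!*[n∸k]!≡n! (∸-monoˡ-≤ ∣ X ∣ a≤y)) ⟨
    f ∣ A ∣ * ((m C k) * (k ! * (m ∸ k) !))
      ≡⟨ *-assoc (f ∣ A ∣) (m C k) _ ⟨
    f ∣ A ∣ * (m C k) * (k ! * (m ∸ k) !)
      ≡⟨ cong₂ _*_ (*-comm (f ∣ A ∣) (m C k)) (cong (λ j → k ! * j !) m∸k) ⟩
    (m C k) * f ∣ A ∣ * w A
      ≤⟨ *-monoˡ-≤ (w A) (le A∈𝓐) ⟩
    b * w A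
      ≡⟨ *-comm b (w A) ⟩
    w A * b ∎
    where
    k = ∣ A ∣ ∸ ∣ X ∣
    x≤a = p⊆q⇒∣p∣≤∣q∣ (proj₁ (bd A∈𝓐))
    a≤y = p⊆q⇒∣p∣≤∣q∣ (proj₂ (bd A∈𝓐))
    m∸k : m ∸ k ≡ ∣ Y ∣ ∸ ∣ A ∣
    m∸k = trans (∸-+-assoc ∣ Y ∣ ∣ X ∣ k) (cong (∣ Y ∣ ∸_) (m+[n∸m]≡n x≤a))

-- The size of a full level inside an interval

between? : (X Y : Subset n) → Decidable (λ A → X ⊆ A × A ⊆ Y)
between? X Y A = (X ⊆? A) ×-dec (A ⊆? Y)

between : Subset n → Subset n → Family n → Family n
between X Y = filter (between? X Y)

-- Induction on the coordinates. Where `X` and `Y` agree, the coordinate of `A` is forced; where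
-- only `Y` has the element, both choices are open and Pascal's rule applies. Writing the sizes as
-- `j + ∣ X ∣` and `m + ∣ X ∣` avoids truncated subtraction.
length-between-level : ∀ {m} j {X Y : Subset n} → X ⊆ Y → ∣ Y ∣ ≡ m + ∣ X ∣ →
  length (between X Y (level n (j + ∣ X ∣))) ≡ m C j
length-between-level {n} j {X} {Y} X⊆Y eq = trans
  (cong length (filter-filter (between? X Y) (λ A → ∣ A ∣ ≟ j + ∣ X ∣) 2^[ n ]))
  (count j _ X Y X⊆Y eq refl)
  where
  P? : ∀ {n} (X Y : Subset n) k → Decidable (λ A → (X ⊆ A × A ⊆ Y) × ∣ A ∣ ≡ k)
  P? X Y k A = between? X Y A ×-dec (∣ A ∣ ≟ k)

  N : ∀ {n} (X Y : Subset n) → ℕ → ℕ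
  N {n} X Y k = length (filter (P? X Y k) 2^[ n ])

  H? : ∀ {n} a x y (X Y : Subset n) k →
       Decidable (λ A → (x ∷ X ⊆ a ∷ A × a ∷ A ⊆ y ∷ Y) × ∣ a ∷ A ∣ ≡ k)
  H? a x y X Y k A = P? (x ∷ X) (y ∷ Y) k (a ∷ A)

  halves : ∀ {n} x y (X Y : Subset n) k → N (x ∷ X) (y ∷ Y) k ≡
    length (filter (H? outside x y X Y k) 2^[ n ]) +
    length (filter (H? inside x y X Y k) 2^[ n ])
  halves {n} x y X Y k = begin
    length (filter P?′ (map (outside ∷_) 2^[ n ] ++ map (inside ∷_) 2^[ n ]))
      ≡⟨ cong length (filter-++ P?′ (map (outside ∷_) 2^[ n ]) _) ⟩
    length (filter P?′ (map (outside ∷_) 2^[ n ]) ++ filter P?′ (map (inside ∷_) 2^[ n ]))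
      ≡⟨ length-++ (filter P?′ (map (outside ∷_) 2^[ n ])) ⟩
    length (filter P?′ (map (outside ∷_) 2^[ n ])) + length (filter P?′ (map (inside ∷_) 2^[ n ]))
      ≡⟨ cong₂ _+_ (length-filter-map P?′ (outside ∷_) 2^[ n ]) (length-filter-map P?′ (inside ∷_) 2^[ n ]) ⟩
    _ ∎
    where
    open ≡-Reasoning
    P?′ = P? (x ∷ X) (y ∷ Y) k

  empty : ∀ {n} {P : Pred (Subset n) 0ℓ} (P? : Decidable P) → (∀ A → ¬ P A) →
          length (filter P? 2^[ n ]) ≡ 0
  empty {n} P? h = cong length (filter-none P? {2^[ n ]} (All.tabulate λ _ → h _))

  same : ∀ {n} {P Q : Pred (Subset n) 0ℓ} (P? : Decidable P) (Q? : Decidable Q) →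
         (∀ {A} → P A → Q A) → (∀ {A} → Q A → P A) →
         length (filter P? 2^[ n ]) ≡ length (filter Q? 2^[ n ])
  same P? Q? f g = cong length (filter-≐ P? Q? (f , g) 2^[ _ ])

  in⊈out : ∀ {n} {X Y : Subset n} → ¬ (inside ∷ X ⊆ outside ∷ Y)
  in⊈out h with () ← h here

  count : ∀ {n m} j k (X Y : Subset n) → X ⊆ Y → ∣ Y ∣ ≡ m + ∣ X ∣ → k ≡ j + ∣ X ∣ → N X Y k ≡ m C j
  count {m = zero} zero _ [] [] X⊆Y eq refl = refl
  count {m = zero} (suc j) _ [] [] X⊆Y eq refl = refl
  count j k (outside ∷ X) (outside ∷ Y) X⊆Y eq k≡ = trans (halves outside outside X Y k) (trans
    (cong₂ _+_
      (same (H? outside outside outside X Y k) (P? X Y k)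
        (λ ((p , q) , e) → (drop-∷-⊆ p , drop-∷-⊆ q) , e)
        (λ ((p , q) , e) → (s⊆s p , s⊆s q) , e))
      (empty (H? inside outside outside X Y k) λ A ((_ , q) , _) → in⊈out q))
    (trans (+-identityʳ _) (count j k X Y (drop-∷-⊆ X⊆Y) eq k≡)))
  count j k (inside ∷ X) (outside ∷ Y) X⊆Y eq k≡ = ⊥-elim (in⊈out X⊆Y)
  count {m = m} j k (inside ∷ X) (inside ∷ Y) X⊆Y eq k≡ = trans (halves inside inside X Y k) (trans
    (cong₂ _+_
      (empty (H? outside inside inside X Y k) λ A ((p , _) , _) → in⊈out p)
      (same (H? inside inside inside X Y k) (P? X Y (j + ∣ X ∣))
        (λ ((p , q) , e) → (drop-∷-⊆ p , drop-∷-⊆ q) , suc-injective (trans e (trans k≡ (+-suc j _))))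
        (λ ((p , q) , e) → (s⊆s p , s⊆s q) , trans (cong suc e) (sym (trans k≡ (+-suc j _))))))
    (count j (j + ∣ X ∣) X Y (drop-∷-⊆ X⊆Y) (suc-injective (trans eq (+-suc m _))) refl))
  count {m = zero} j k (outside ∷ X) (inside ∷ Y) X⊆Y eq k≡ =
    ⊥-elim (<-irrefl (sym eq) (s≤s (p⊆q⇒∣p∣≤∣q∣ (drop-∷-⊆ X⊆Y))))
  count {m = suc m} j k (outside ∷ X) (inside ∷ Y) X⊆Y eq k≡ = trans (halves outside inside X Y k) (trans
    (cong (_+ _) (trans
      (same (H? outside outside inside X Y k) (P? X Y k)
        (λ ((p , q) , e) → (drop-∷-⊆ p , drop-∷-⊆ q) , e)
        (λ ((p , q) , e) → (s⊆s p , out⊆ q) , e))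
      (count j k X Y (drop-∷-⊆ X⊆Y) (suc-injective eq) k≡)))
    (pascal j k≡))
    where
    pascal : ∀ j → k ≡ j + ∣ X ∣ →
      m C j + length (filter (H? inside outside inside X Y k) 2^[ _ ]) ≡ suc m C j
    -- For `j = 0` the set has only the size of `X`, so it has no room for an element outside `X`.
    pascal zero k≡ = cong (1 +_) (empty (H? inside outside inside X Y k) λ A ((p , _) , e) →
      <-irrefl (trans (sym k≡) (sym e)) (s≤s (p⊆q⇒∣p∣≤∣q∣ (drop-∷-⊆ p))))
    pascal (suc j) refl = trans (cong (_ +_) (trans
      (same (H? inside outside inside X Y k) (P? X Y (j + ∣ X ∣))
        (λ ((p , q) , e) → (drop-∷-⊆ p , drop-∷-⊆ q) , suc-injective e)
        (λ ((p , q) , e) → (out⊆ p , s⊆s q) , cong suc e))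
      (count j (j + ∣ X ∣) X Y (drop-∷-⊆ X⊆Y) (suc-injective eq) refl)))
      (trans (+-comm (m C suc j) (m C j)) (nCk+nC[k+1]≡[n+1]C[k+1] m j))

-- Maxima over ranges of sizes, and shapes of multi-level posets

⨆ : ℕ → ℕ → (ℕ → ℕ) → ℕ
⨆ b e f = max 0 (map f (filter (b ≤?_) (upTo e)))

≤-⨆ : ∀ {b e k} f → b ≤ k → k < e → f k ≤ ⨆ b e f
≤-⨆ {b} {e} f b≤k k<e = All.lookup (xs≤max 0 (map f (filter (b ≤?_) (upTo e))))
  (∈-map⁺ f (∈-filter⁺ (b ≤?_) (∈-upTo⁺ k<e) b≤k))

-- The value 0 is set apart because an empty range has maximum 0 without any size that attains it.
⨆-attained : ∀ b e f → ⨆ b e f ≡ 0 ⊎ ∃[ k ] (b ≤ k × k < e × ⨆ b e f ≡ f k)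
⨆-attained b e f with argmax-sel id 0 (map f (filter (b ≤?_) (upTo e)))
... | inj₁ eq = inj₁ eq
... | inj₂ m with ∈-map⁻ f m
...   | k , k∈ , eq with ∈-filter⁻ (b ≤?_) {xs = upTo e} k∈
...     | k∈′ , b≤k = inj₂ (k , b≤k , ∈-upTo⁻ k∈′ , eq)

-- A multi-level poset without two consecutive levels of size at least 2, read from the bottom:
-- every level is a singleton, or the top level, or lies just below a singleton.
data Shape : (s : ℕ) → (Fin s → ℕ) → Set where
  nil  : {r : Fin 0 → ℕ} → Shape 0 r
  one  : {r : Fin (suc s) → ℕ} → r zero ≡ 1 → Shape s (r ∘ suc) → Shape (suc s) r
  last : {r : Fin 1 → ℕ} → 1 ≤ r zero → Shape 1 r
  two  : {r : Fin (2+ s) → ℕ} → 1 ≤ r zero → r (suc zero) ≡ 1 → Shape s ((r ∘ suc) ∘ suc) →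
         Shape (2+ s) r

-- The hypothesis on the two lowest levels decides between `one` and `two`; the latter consumes both
-- levels, since the lower one is counted inside the interval that the singleton above it closes.
shape : (r : Fin s → ℕ) → (∀ i → 1 ≤ r i) →
        (∀ i j → toℕ j ≡ suc (toℕ i) → r i ≡ 1 ⊎ r j ≡ 1) → Shape s r
shape {zero}        r pos alt = nil
shape {suc zero}    r pos alt = last (pos zero)
shape {suc (suc s)} r pos alt =
  [ (λ r₀≡1 → one r₀≡1
      (shape (r ∘ suc) (pos ∘ suc) λ i j e → alt (suc i) (suc j) (cong suc e)))
  , (λ r₁≡1 → two (pos zero) r₁≡1
      (shape ((r ∘ suc) ∘ suc) ((pos ∘ suc) ∘ suc)
        λ i j e → alt (suc (suc i)) (suc (suc j)) (cong (λ k → suc (suc k)) e)))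
  ]′ (alt zero (suc zero) refl)

-- Enumeration of the tuples of levels

above : Subset n → Family n → Family n
above X = between X ⊤

-- The enumeration follows the order of the count, which makes its length a sum of products. In
-- `two` the singleton `A` of the second level is chosen first, and the level below it then varies
-- in `[X , A]`.
tuples : Shape s r → (Fin s → Family n) → Subset n → List (Vec (Family n) s)
tuples nil F X = [] ∷ []
tuples (one _ sh) F X =
  concatMap (λ A → map ((A ∷ []) ∷_) (tuples sh (F ∘ suc) A)) (above X (F zero))
tuples (last {r} _) F X = map (_∷ []) (choose (r zero) (above X (F zero)))
tuples (two {r = r} _ _ sh) F X =
  concatMap (λ A →
    concatMap (λ 𝓖 → map (λ v → 𝓖 ∷ (A ∷ []) ∷ v) (tuples sh ((F ∘ suc) ∘ suc) A))
      (choose (r zero) (between X A (F zero))))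
    (above X (F (suc zero)))

-- The specification of `tuples`, free of the shape: by `tuples-complete` and `tuples-sound` the
-- enumeration lists exactly these vectors. Copies are compared with tuples through it.
record IsTuple (r : Fin s → ℕ) (F : Fin s → Family n) (X : Subset n)
               (v : Vec (Family n) s) : Set where
  field
    sublist : ∀ i → Vec.lookup v i ⊑ F i
    size    : ∀ i → length (Vec.lookup v i) ≡ r i
    lower   : ∀ i {A} → A ∈ Vec.lookup v i → X ⊆ A
    ordered : ∀ {i j A B} → i Fin.< j → A ∈ Vec.lookup v i → B ∈ Vec.lookup v j → A ⊆ B

open IsTuple

⊑-filter : {P : Pred A p} (P? : Decidable P) {xs ys : List A} → xs ⊑ ys →
           (∀ {x} → x ∈ xs → P x) → xs ⊑ filter P? ys
⊑-filter P? {ys = ys} xs⊑ys h = subst (_⊑ filter P? ys) (filter-all P? (All.tabulate h))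
  (Sublistₚ.filter⁺ P? P? (λ { refl px → px }) xs⊑ys)

∈-choose⁺ : ∀ {k} {𝓖 𝓕 : Family n} → 𝓖 ⊑ 𝓕 → length 𝓖 ≡ k → 𝓖 ∈ choose k 𝓕
∈-choose⁺ {k = k} sub len = ∈-filter⁺ (λ 𝓖 → length 𝓖 ≟ k) (⊑⇒∈-subfamilies sub) len

∈-choose⁻ : ∀ {k} {𝓖 : Family n} 𝓕 → 𝓖 ∈ choose k 𝓕 → 𝓖 ⊑ 𝓕 × length 𝓖 ≡ k
∈-choose⁻ {k = k} 𝓕 m with ∈-filter⁻ (λ 𝓖 → length 𝓖 ≟ k) {xs = subfamilies 𝓕} m
... | m′ , len = ∈-subfamilies⇒⊑ 𝓕 m′ , len

∈-between⁺ : ∀ {X Y A : Subset n} {𝓕} → A ∈ 𝓕 → X ⊆ A → A ⊆ Y → A ∈ between X Y 𝓕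
∈-between⁺ {X = X} {Y} m X⊆A A⊆Y = ∈-filter⁺ (between? X Y) m (X⊆A , A⊆Y)

∈-between⁻ : ∀ {X Y A : Subset n} 𝓕 → A ∈ between X Y 𝓕 → A ∈ 𝓕 × X ⊆ A × A ⊆ Y
∈-between⁻ {X = X} {Y} 𝓕 = ∈-filter⁻ (between? X Y) {xs = 𝓕}

IsTuple-tail : {F : Fin (suc s) → Family n} {X A : Subset n} {r : Fin (suc s) → ℕ}
  {𝓖 : Family n} {v : Vec (Family n) s} → A ∈ 𝓖 →
  IsTuple r F X (𝓖 ∷ v) → IsTuple (r ∘ suc) (F ∘ suc) A v
IsTuple-tail A∈𝓖 t = record
  { sublist = λ i → sublist t (suc i)
  ; size    = λ i → size t (suc i)
  ; lower   = λ i B∈ → ordered t {zero} {suc i} z<s A∈𝓖 B∈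
  ; ordered = λ {i} {j} i<j → ordered t {suc i} {suc j} (s<s i<j)
  }

-- The set `A` separates the lowest level from the rest: all of `𝓖` lies below `A` and everything
-- later lies above it, so no pair across the two parts has to be compared directly.
IsTuple-cons : {F : Fin (suc s) → Family n} {X A : Subset n} {r : Fin (suc s) → ℕ}
  {𝓖 : Family n} {v : Vec (Family n) s} → 𝓖 ⊑ F zero → length 𝓖 ≡ r zero →
  (∀ {B} → B ∈ 𝓖 → X ⊆ B × B ⊆ A) → X ⊆ A →
  IsTuple (r ∘ suc) (F ∘ suc) A v → IsTuple r F X (𝓖 ∷ v)
IsTuple-cons {s = s} {X = X} {A} {𝓖 = 𝓖} {v} sub len bd X⊆A t = record
  { sublist = λ { zero → sub ; (suc i) → sublist t i }
  ; size    = λ { zero → len ; (suc i) → size t i }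
  ; lower   = λ { zero B∈ → proj₁ (bd B∈) ; (suc i) B∈ → ⊆-trans′ X⊆A (lower t i B∈) }
  ; ordered = λ {i} {j} → ord i j
  }
  where
  ⊆-trans′ : ∀ {X Y Z : Subset _} → X ⊆ Y → Y ⊆ Z → X ⊆ Z
  ⊆-trans′ f g x∈ = g (f x∈)
  ord : ∀ i j {B C} → i Fin.< j → B ∈ Vec.lookup (𝓖 ∷ v) i → C ∈ Vec.lookup (𝓖 ∷ v) j → B ⊆ C
  ord zero    (suc j) i<j B∈ C∈ = ⊆-trans′ (proj₂ (bd B∈)) (lower t j C∈)
  ord (suc i) (suc j) i<j B∈ C∈ = ordered t (s<s⁻¹ i<j) B∈ C∈

length≡1⇒singleton : (xs : List A) → length xs ≡ 1 → ∃[ x ] xs ≡ x ∷ []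
length≡1⇒singleton (x ∷ []) _ = x , refl

tuples-complete : (sh : Shape s r) (F : Fin s → Family n) (X : Subset n) (v : Vec (Family n) s) →
                  IsTuple r F X v → v ∈ tuples sh F X
tuples-complete nil F X [] t = here refl
tuples-complete (one r₀≡1 sh) F X (𝓖 ∷ v) t with length≡1⇒singleton 𝓖 (trans (size t zero) r₀≡1)
... | A , refl = ∈-concatMap⁺ _ (lose
  (∈-between⁺ (⊑-lookup (sublist t zero) (here refl)) (lower t zero (here refl)) ⊆⊤)
  (∈-map⁺ _ (tuples-complete sh (F ∘ suc) A v (IsTuple-tail (here refl) t))))
tuples-complete (last _) F X (𝓖 ∷ []) t =
  ∈-map⁺ (_∷ []) (∈-choose⁺ (⊑-filter (between? X ⊤) (sublist t zero) (λ A∈ → lower t zero A∈ , ⊆⊤)) (size t zero))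
tuples-complete (two _ r₁≡1 sh) F X (𝓖 ∷ 𝓗 ∷ v) t with length≡1⇒singleton 𝓗 (trans (size t (suc zero)) r₁≡1)
... | A , refl = ∈-concatMap⁺ _ (lose
  (∈-between⁺ (⊑-lookup (sublist t (suc zero)) (here refl)) (lower t (suc zero) (here refl)) ⊆⊤)
  (∈-concatMap⁺ _ (lose
    (∈-choose⁺ (⊑-filter (between? X A) (sublist t zero)
      (λ B∈ → lower t zero B∈ , ordered t {zero} {suc zero} z<s B∈ (here refl))) (size t zero))
    (∈-map⁺ _ (tuples-complete sh ((F ∘ suc) ∘ suc) A v tail)))))
  where
  tail : IsTuple _ ((F ∘ suc) ∘ suc) A v
  tail = record
    { sublist = λ i → sublist t (suc (suc i))
    ; size    = λ i → size t (suc (suc i))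
    ; lower   = λ i B∈ → ordered t {suc zero} {suc (suc i)} (s<s z<s) (here refl) B∈
    ; ordered = λ {i} {j} i<j → ordered t {suc (suc i)} {suc (suc j)} (s<s (s<s i<j))
    }

tuples-sound : (sh : Shape s r) (F : Fin s → Family n) (X : Subset n) (v : Vec (Family n) s) →
               v ∈ tuples sh F X → IsTuple r F X v
tuples-sound nil F X [] m = record { sublist = λ () ; size = λ () ; lower = λ () ; ordered = λ {} }
tuples-sound (one r₀≡1 sh) F X v m with find (∈-concatMap⁻ _ {xs = above X (F zero)} m)
... | A , A∈ , m′ with ∈-map⁻ _ m′ | ∈-between⁻ (F zero) A∈
...   | w , w∈ , refl | A∈F , X⊆A , _ = IsTuple-cons (from∈ A∈F) (sym r₀≡1)
  (λ { (here refl) → X⊆A , λ x∈ → x∈ }) X⊆A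
  (tuples-sound sh (F ∘ suc) A w w∈)
tuples-sound (last _) F X v m with ∈-map⁻ (_∷ []) m
... | 𝓖 , 𝓖∈ , refl with ∈-choose⁻ (above X (F zero)) 𝓖∈
-- Nothing follows the top level, so the full set serves as the separating set.
...   | sub , len = IsTuple-cons {A = ⊤} (⊆-trans sub (Sublistₚ.filter-⊆ (between? X ⊤) (F zero))) len
  (λ B∈ → proj₂ (∈-between⁻ (F zero) (⊑-lookup sub B∈))) ⊆⊤
  (record { sublist = λ () ; size = λ () ; lower = λ () ; ordered = λ {} })
tuples-sound (two _ r₁≡1 sh) F X v m with find (∈-concatMap⁻ _ {xs = above X (F (suc zero))} m)
... | A , A∈ , m′ with find (∈-concatMap⁻ _ {xs = choose _ (between X A (F zero))} m′)
...   | 𝓖 , 𝓖∈ , m″ with ∈-map⁻ _ m″ | ∈-between⁻ (F (suc zero)) A∈ | ∈-choose⁻ (between X A (F zero)) 𝓖∈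
...     | w , w∈ , refl | A∈F , X⊆A , _ | sub , len =
  IsTuple-cons {A = A} (⊆-trans sub (Sublistₚ.filter-⊆ (between? X A) (F zero))) len
    (λ B∈ → proj₂ (∈-between⁻ (F zero) (⊑-lookup sub B∈))) X⊆A
    (IsTuple-cons (from∈ A∈F) (sym r₁≡1) (λ { (here refl) → (λ x∈ → x∈) , λ x∈ → x∈ }) (λ x∈ → x∈)
      (tuples-sound sh ((F ∘ suc) ∘ suc) A w w∈))

-- The choices of `A` and `𝓖` can be read off the resulting vector, so different choices contribute
-- disjoint parts of the list.
tuples-unique : (sh : Shape s r) (F : Fin s → Family n) (X : Subset n) → (∀ i → Unique (F i)) →
                Unique (tuples sh F X)
tuples-unique nil F X u = All.[] ∷ []
tuples-unique (one _ sh) F X u = concatMap-unique (Uniqueₚ.filter⁺ (between? X ⊤) (u zero))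
  (λ {A} _ → Uniqueₚ.map⁺ Vecₚ.∷-injectiveʳ (tuples-unique sh (F ∘ suc) A (u ∘ suc)))
  λ _ _ m m′ → agree m m′
  where
  agree : ∀ {A B v} {xs ys : List (Vec (Family _) _)} →
    v ∈ map ((A ∷ []) ∷_) xs → v ∈ map ((B ∷ []) ∷_) ys → A ≡ B
  agree m m′ with ∈-map⁻ _ m | ∈-map⁻ _ m′
  ... | _ , _ , refl | _ , _ , refl = refl
tuples-unique (last {r} _) F X u = Uniqueₚ.map⁺ Vecₚ.∷-injectiveˡ
  (Uniqueₚ.filter⁺ (λ 𝓖 → length 𝓖 ≟ r zero) (subfamilies-unique (Uniqueₚ.filter⁺ (between? X ⊤) (u zero))))
tuples-unique {n = n} (two {r = r} _ _ sh) F X u =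
  concatMap-unique (Uniqueₚ.filter⁺ (between? X ⊤) (u (suc zero)))
    (λ {A} _ → concatMap-unique
      (Uniqueₚ.filter⁺ (λ 𝓖 → length 𝓖 ≟ r zero)
        (subfamilies-unique (Uniqueₚ.filter⁺ (between? X A) (u zero))))
      (λ _ → Uniqueₚ.map⁺ (Vecₚ.∷-injectiveʳ ∘ Vecₚ.∷-injectiveʳ)
        (tuples-unique sh ((F ∘ suc) ∘ suc) A ((u ∘ suc) ∘ suc)))
      (λ _ _ m m′ → proj₁ (agree m m′)))
    (λ {A} {B} _ _ m m′ →
      let _ , _ , m₁ = find (∈-concatMap⁻ _ {xs = choose (r zero) (between X A (F zero))} m)
          _ , _ , m₂ = find (∈-concatMap⁻ _ {xs = choose (r zero) (between X B (F zero))} m′)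
      in proj₂ (agree m₁ m₂))
  where
  agree : ∀ {k} {A B : Subset n} {𝓖 𝓗 : Family n} {v : Vec (Family n) (2+ k)}
    {xs ys : List (Vec (Family n) k)} →
    v ∈ map (λ w → 𝓖 ∷ (A ∷ []) ∷ w) xs → v ∈ map (λ w → 𝓗 ∷ (B ∷ []) ∷ w) ys → 𝓖 ≡ 𝓗 × A ≡ B
  agree {A = A} {B} {𝓖} {𝓗} m m′
    with ∈-map⁻ (λ w → 𝓖 ∷ (A ∷ []) ∷ w) m | ∈-map⁻ (λ w → 𝓗 ∷ (B ∷ []) ∷ w) m′
  ... | _ , _ , refl | _ , _ , refl = refl , refl

-- The maximum of products of binomial coefficients from the count. Here `x` is the size of the last
-- singleton chosen and `b` the least size allowed next; `(n ∸ x) C (k ∸ x)` counts the k-sets above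
-- an x-set, and `(k ∸ x) C (j ∸ x)` the j-sets between an x-set and a k-set. In `last` and `two`
-- the maximum stands inside `_C r zero`, which is monotone.
bound : ℕ → Shape s r → ℕ → ℕ → ℕ
bound n nil x b = 1
bound n (one _ sh) x b = ⨆ b (suc n) λ k → ((n ∸ x) C (k ∸ x)) * bound n sh k (suc k)
bound n (last {r} _) x b = (⨆ b (suc n) λ k → (n ∸ x) C (k ∸ x)) C r zero
bound n (two {r = r} _ _ sh) x b = ⨆ b (suc n) λ k → ((n ∸ x) C (k ∸ x)) *
  (((⨆ b k λ j → (k ∸ x) C (j ∸ x)) C r zero) * bound n sh k (suc k))

-- The number of tuples in a layered family

length-tuples-one : ∀ {r : Fin (suc s) → ℕ} (r₀≡1 : r zero ≡ 1) (sh : Shape s (r ∘ suc))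
  (F : Fin (suc s) → Family n) (X : Subset n) →
  length (tuples (one {r = r} r₀≡1 sh) F X) ≡
  ∑ (above X (F zero)) (λ A → length (tuples sh (F ∘ suc) A))
length-tuples-one _ sh F X = trans (length-concatMap _ (above X (F zero)))
  (∑-cong (above X (F zero)) λ _ → length-map _ (tuples sh (F ∘ suc) _))

length-tuples-last : ∀ {r : Fin 1 → ℕ} (1≤r₀ : 1 ≤ r zero) (F : Fin 1 → Family n) (X : Subset n) →
  length (tuples (last {r} 1≤r₀) F X) ≡ length (above X (F zero)) C r zero
length-tuples-last {r = r} _ F X = trans (length-map _ (choose (r zero) (above X (F zero))))
  (length-choose (r zero) (above X (F zero)))

length-tuples-two : ∀ {r : Fin (2+ s) → ℕ} (1≤r₀ : 1 ≤ r zero) (r₁≡1 : r (suc zero) ≡ 1)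
  (sh : Shape s ((r ∘ suc) ∘ suc)) (F : Fin (2+ s) → Family n) (X : Subset n) →
  length (tuples (two {r = r} 1≤r₀ r₁≡1 sh) F X) ≡ ∑ (above X (F (suc zero)))
    (λ A → (length (between X A (F zero)) C r zero) * length (tuples sh ((F ∘ suc) ∘ suc) A))
length-tuples-two {r = r} _ _ sh F X = trans (length-concatMap _ (above X (F (suc zero))))
  (∑-cong (above X (F (suc zero))) λ {A} _ → begin
    length (concatMap _ (choose (r zero) (between X A (F zero))))
      ≡⟨ length-concatMap _ (choose (r zero) (between X A (F zero))) ⟩
    ∑ (choose (r zero) (between X A (F zero))) _
      ≡⟨ ∑-cong (choose (r zero) (between X A (F zero))) (λ _ → length-map _ (tuples sh ((F ∘ suc) ∘ suc) A)) ⟩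
    ∑ (choose (r zero) (between X A (F zero))) (λ _ → length (tuples sh ((F ∘ suc) ∘ suc) A))
      ≡⟨ ∑-const (choose (r zero) (between X A (F zero))) _ ⟩
    length (choose (r zero) (between X A (F zero))) * length (tuples sh ((F ∘ suc) ∘ suc) A)
      ≡⟨ cong (_* length (tuples sh ((F ∘ suc) ∘ suc) A)) (length-choose (r zero) (between X A (F zero))) ⟩
    (length (between X A (F zero)) C r zero) * length (tuples sh ((F ∘ suc) ∘ suc) A) ∎)
  where open ≡-Reasoning

-- What the upper bound needs from the layers. The field `size-<` amounts to their disjointness, in
-- the form in which it pushes sizes up.
record Layered (F : Fin s → Family n) : Set where
  field
    unique    : ∀ i → Unique (F i)
    antichain : ∀ i → Antichain (F i)
    size-<    : ∀ {i j A B} → i Fin.< j → A ∈ F i → B ∈ F j → A ⊆ B → ∣ A ∣ < ∣ B ∣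

open Layered

Layered-tail : {F : Fin (suc s) → Family n} → Layered F → Layered (F ∘ suc)
Layered-tail l = record
  { unique    = unique l ∘ suc
  ; antichain = λ i → antichain l (suc i)
  ; size-<    = λ {i} {j} i<j → size-< l {suc i} {suc j} (s<s i<j)
  }

between-lym : {X Y : Subset n} {𝓕 : Family n} (f : ℕ → ℕ) (b : ℕ) → X ⊆ Y →
  Unique 𝓕 → Antichain 𝓕 →
  (∀ {A} → A ∈ 𝓕 → X ⊆ A → A ⊆ Y → ((∣ Y ∣ ∸ ∣ X ∣) C (∣ A ∣ ∸ ∣ X ∣)) * f (∣ A ∣) ≤ b) →
  ∑ (between X Y 𝓕) (f ∘ ∣_∣) ≤ b
between-lym {X = X} {Y} {𝓕} f b X⊆Y u anti le = weighted-lym f b X⊆Y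
  (Uniqueₚ.filter⁺ (between? X Y) u)
  (λ A∈ B∈ → anti (proj₁ (∈-between⁻ 𝓕 A∈)) (proj₁ (∈-between⁻ 𝓕 B∈)))
  (λ A∈ → proj₂ (∈-between⁻ 𝓕 A∈))
  (λ A∈ → let A∈𝓕 , X⊆A , A⊆Y = ∈-between⁻ 𝓕 A∈ in le A∈𝓕 X⊆A A⊆Y)

-- The case of constant weight 1, that is, Sperner's theorem in an interval.
between-sperner : {X Y : Subset n} {𝓕 : Family n} (b : ℕ) → X ⊆ Y →
  Unique 𝓕 → Antichain 𝓕 →
  (∀ {A} → A ∈ 𝓕 → X ⊆ A → A ⊆ Y → ((∣ Y ∣ ∸ ∣ X ∣) C (∣ A ∣ ∸ ∣ X ∣)) ≤ b) →
  length (between X Y 𝓕) ≤ b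
between-sperner {X = X} {Y} {𝓕} b X⊆Y u anti le = subst (_≤ b)
  (trans (∑-const (between X Y 𝓕) 1) (*-identityʳ _))
  (between-lym (λ _ → 1) b X⊆Y u anti λ A∈ p q → subst (_≤ b) (sym (*-identityʳ _)) (le A∈ p q))

-- A lower bound b on the sizes, rather than X ⊆ A alone, records that the next
-- chosen set is strictly larger than the previous one.
length-tuples-≤ : (sh : Shape s r) {F : Fin s → Family n} → Layered F → (X : Subset n) (b : ℕ) →
  (∀ {i A} → A ∈ F i → X ⊆ A → b ≤ ∣ A ∣) → length (tuples sh F X) ≤ bound n sh (∣ X ∣) b
length-tuples-≤ nil l X b low = ≤-refl
length-tuples-≤ {n = n} (one {r = r} r₀≡1 sh) {F} l X b low = begin
  length (tuples (one {r = r} r₀≡1 sh) F X)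
    ≡⟨ length-tuples-one {r = r} r₀≡1 sh F X ⟩
  ∑ (above X (F zero)) (λ A → length (tuples sh (F ∘ suc) A))
    ≤⟨ ∑-mono (above X (F zero)) (λ {A} A∈ → length-tuples-≤ sh (Layered-tail l) A (suc (∣ A ∣))
         λ {i} B∈ → size-< l {zero} {suc i} z<s (proj₁ (∈-between⁻ (F zero) A∈)) B∈) ⟩
  ∑ (above X (F zero)) (λ A → bound n sh (∣ A ∣) (suc (∣ A ∣)))
    ≤⟨ between-lym (λ k → bound n sh k (suc k)) _ ⊆⊤ (unique l zero) (antichain l zero)
         (λ {A} A∈ X⊆A _ → subst (λ m → ((m ∸ ∣ X ∣) C (∣ A ∣ ∸ ∣ X ∣)) * bound n sh (∣ A ∣) (suc (∣ A ∣)) ≤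
                                  bound n (one {r = r} r₀≡1 sh) (∣ X ∣) b) (sym (∣⊤∣≡n n))
           (≤-⨆ (λ k → ((n ∸ ∣ X ∣) C (k ∸ ∣ X ∣)) * bound n sh k (suc k)) (low A∈ X⊆A) (s≤s (∣p∣≤n A)))) ⟩
  bound n (one {r = r} r₀≡1 sh) (∣ X ∣) b ∎
  where open ≤-Reasoning
length-tuples-≤ {n = n} (last {r} 1≤r₀) {F} l X b low = subst (_≤ bound n (last {r} 1≤r₀) (∣ X ∣) b)
  (sym (length-tuples-last {r = r} 1≤r₀ F X))
  (C-monoˡ-≤ (r zero) (between-sperner _ ⊆⊤ (unique l zero) (antichain l zero)
    (λ {A} A∈ X⊆A _ → subst (λ m → ((m ∸ ∣ X ∣) C (∣ A ∣ ∸ ∣ X ∣)) ≤ ⨆ b (suc n) (λ k → (n ∸ ∣ X ∣) C (k ∸ ∣ X ∣))) (sym (∣⊤∣≡n n))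
      (≤-⨆ (λ k → (n ∸ ∣ X ∣) C (k ∸ ∣ X ∣)) (low A∈ X⊆A) (s≤s (∣p∣≤n A))))))
length-tuples-≤ {n = n} (two {r = r} 1≤r₀ r₁≡1 sh) {F} l X b low = begin
  length (tuples (two {r = r} 1≤r₀ r₁≡1 sh) F X)
    ≡⟨ length-tuples-two {r = r} 1≤r₀ r₁≡1 sh F X ⟩
  ∑ (above X (F (suc zero))) (λ A → (length (between X A (F zero)) C r zero) * length (tuples sh ((F ∘ suc) ∘ suc) A))
    ≤⟨ ∑-mono (above X (F (suc zero))) (λ {A} A∈ →
         let A∈F , X⊆A , _ = ∈-between⁻ (F (suc zero)) A∈ in *-mono-≤
           (C-monoˡ-≤ (r zero) (between-sperner _ X⊆A (unique l zero) (antichain l zero)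
             -- A set of the lower layer inside `A` is strictly smaller than `A`, so the inner
             -- maximum may stop before the size of `A`.
             λ B∈ X⊆B B⊆A → ≤-⨆ (λ j → (∣ A ∣ ∸ ∣ X ∣) C (j ∸ ∣ X ∣)) (low B∈ X⊆B)
               (size-< l {zero} {suc zero} z<s B∈ A∈F B⊆A)))
           (length-tuples-≤ sh (Layered-tail (Layered-tail l)) A (suc (∣ A ∣))
             λ {i} B∈ → size-< l {suc zero} {suc (suc i)} (s<s z<s) A∈F B∈)) ⟩
  ∑ (above X (F (suc zero))) (f ∘ ∣_∣)
    ≤⟨ between-lym f _ ⊆⊤ (unique l (suc zero)) (antichain l (suc zero))
         (λ {A} A∈ X⊆A _ → subst (λ m → ((m ∸ ∣ X ∣) C (∣ A ∣ ∸ ∣ X ∣)) * f (∣ A ∣) ≤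
                                  bound n (two {r = r} 1≤r₀ r₁≡1 sh) (∣ X ∣) b) (sym (∣⊤∣≡n n))
           (≤-⨆ (λ k → ((n ∸ ∣ X ∣) C (k ∸ ∣ X ∣)) * f k) (low A∈ X⊆A) (s≤s (∣p∣≤n A)))) ⟩
  bound n (two {r = r} 1≤r₀ r₁≡1 sh) (∣ X ∣) b ∎
  where
  open ≤-Reasoning
  f : ℕ → ℕ
  f k = ((⨆ b k λ j → (k ∸ ∣ X ∣) C (j ∸ ∣ X ∣)) C r zero) * bound n sh k (suc k)

-- Full levels that attain the bound

record LevelChoice (n b : ℕ) (ks : Fin s → ℕ) : Set where
  field
    lower      : ∀ i → b ≤ ks i
    upper      : ∀ i → ks i ≤ n
    increasing : ∀ {i j} → i Fin.< j → ks i < ks j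

open LevelChoice

LevelChoice-cons : ∀ {b k} {ks : Fin s → ℕ} → b ≤ k → k ≤ n → LevelChoice n (suc k) ks →
                   LevelChoice n b (k Vector.∷ ks)
LevelChoice-cons {n = n} {b} {k} {ks} b≤k k≤n c = record
  { lower      = λ { zero → b≤k ; (suc i) → ≤-trans b≤k (<⇒≤ (lower c i)) }
  ; upper      = λ { zero → k≤n ; (suc i) → upper c i }
  ; increasing = λ {i} {j} → inc i j
  }
  where
  inc : ∀ i j → i Fin.< j → (k Vector.∷ ks) i < (k Vector.∷ ks) j
  inc zero    (suc j) _   = lower c j
  inc (suc i) (suc j) i<j = increasing c (s<s⁻¹ i<j)

length-between-level′ : ∀ {k} (X Y : Subset n) → X ⊆ Y → ∣ X ∣ ≤ k →
  length (between X Y (level n k)) ≡ (∣ Y ∣ ∸ ∣ X ∣) C (k ∸ ∣ X ∣)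
length-between-level′ {n} {k} X Y X⊆Y x≤k =
  trans (cong (λ z → length (between X Y (level n z))) (sym (m∸n+n≡m x≤k)))
    (length-between-level (k ∸ ∣ X ∣) {X} {Y} X⊆Y (sym (m∸n+n≡m (p⊆q⇒∣p∣≤∣q∣ X⊆Y))))

length-above-level : ∀ {k} (X : Subset n) → ∣ X ∣ ≤ k →
  length (above X (level n k)) ≡ (n ∸ ∣ X ∣) C (k ∸ ∣ X ∣)
length-above-level {n} {k} X x≤k = trans (length-between-level′ X ⊤ ⊆⊤ x≤k)
  (cong (λ m → (m ∸ ∣ X ∣) C (k ∸ ∣ X ∣)) (∣⊤∣≡n n))

∈-level⁻ : ∀ {k} {A : Subset n} → A ∈ level n k → ∣ A ∣ ≡ k
∈-level⁻ {n} {k} A∈ = proj₂ (∈-filter⁻ (λ A → ∣ A ∣ ≟ k) {xs = 2^[ n ]} A∈)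

∑-above-level : ∀ {k m} (X : Subset n) (f : Subset n → ℕ) → ∣ X ∣ ≤ k →
  (∀ {A} → X ⊆ A → ∣ A ∣ ≡ k → m ≤ f A) →
  ((n ∸ ∣ X ∣) C (k ∸ ∣ X ∣)) * m ≤ ∑ (above X (level n k)) f
∑-above-level {n} {k} {m} X f x≤k h = begin
  ((n ∸ ∣ X ∣) C (k ∸ ∣ X ∣)) * m          ≡⟨ cong (_* m) (length-above-level X x≤k) ⟨
  length (above X (level n k)) * m         ≡⟨ ∑-const (above X (level n k)) m ⟨
  ∑ (above X (level n k)) (λ _ → m)        ≤⟨ ∑-mono (above X (level n k)) (λ A∈ →
    let A∈level , X⊆A , _ = ∈-between⁻ (level n k) A∈ in h X⊆A (∈-level⁻ A∈level)) ⟩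
  ∑ (above X (level n k)) f                ∎
  where open ≤-Reasoning

levels : (Fin s → ℕ) → Fin s → Family n
levels {n = n} ks i = level n (ks i)

-- Take a maximizing size at every stage. Over full levels the count depends on `X` through its size
-- only, so one choice of upper levels serves all sets `A` of the level below them simultaneously;
-- hence `ks` is chosen before `X`. If some maximum is 0, the whole product vanishes.
bound-attained : (sh : Shape s r) (n x b : ℕ) → x ≤ b →
  bound n sh x b ≡ 0 ⊎
  ∃[ ks ] (LevelChoice n b ks ×
           ((X : Subset n) → ∣ X ∣ ≡ x → bound n sh x b ≤ length (tuples sh (levels ks) X)))
bound-attained nil n x b x≤b = inj₂
  ((λ ()) , record { lower = λ () ; upper = λ () ; increasing = λ {} } , λ _ _ → ≤-refl)
bound-attained (one {r = r} r₀≡1 sh) n x b x≤b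
  with ⨆-attained b (suc n) (λ k → ((n ∸ x) C (k ∸ x)) * bound n sh k (suc k))
... | inj₁ eq = inj₁ eq
... | inj₂ (k , b≤k , k<1+n , eq) with bound-attained sh n k (suc k) (n≤1+n k)
...   | inj₁ eq₀ = inj₁ (trans eq (trans (cong (((n ∸ x) C (k ∸ x)) *_) eq₀) (*-zeroʳ ((n ∸ x) C (k ∸ x)))))
...   | inj₂ (ks , c , att) = inj₂ (k Vector.∷ ks , LevelChoice-cons b≤k (s≤s⁻¹ k<1+n) c , λ { X refl → begin
  bound n (one {r = r} r₀≡1 sh) x b
    ≡⟨ eq ⟩
  ((n ∸ x) C (k ∸ x)) * bound n sh k (suc k)
    ≤⟨ ∑-above-level X (λ A → length (tuples sh (levels ks) A)) (≤-trans x≤b b≤k) (λ _ → att _) ⟩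
  ∑ (above X (level n k)) (λ A → length (tuples sh (levels ks) A))
    ≡⟨ length-tuples-one {r = r} r₀≡1 sh (levels (k Vector.∷ ks)) X ⟨
  length (tuples (one {r = r} r₀≡1 sh) (levels (k Vector.∷ ks)) X) ∎ })
  where open ≤-Reasoning
bound-attained (last {r} 1≤r₀) n x b x≤b with ⨆-attained b (suc n) (λ k → (n ∸ x) C (k ∸ x))
-- Here `1 ≤ r zero` matters: `0 C 0` would be 1.
... | inj₁ eq = inj₁ (trans (cong (_C r zero) eq) (k>n⇒nCk≡0 1≤r₀))
... | inj₂ (k , b≤k , k<1+n , eq) = inj₂
  ( (λ _ → k)
  , record { lower = λ _ → b≤k ; upper = λ _ → s≤s⁻¹ k<1+n ; increasing = λ { {zero} {zero} () } }
  , λ { X refl → ≤-reflexive (trans (cong (_C r zero) (trans eq (sym (length-above-level X (≤-trans x≤b b≤k)))))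
                  (sym (length-tuples-last {r = r} 1≤r₀ (levels (λ _ → k)) X))) })
bound-attained (two {r = r} 1≤r₀ r₁≡1 sh) n x b x≤b
  with ⨆-attained b (suc n) (λ k → ((n ∸ x) C (k ∸ x)) *
         (((⨆ b k λ j → (k ∸ x) C (j ∸ x)) C r zero) * bound n sh k (suc k)))
... | inj₁ eq = inj₁ eq
... | inj₂ (k , b≤k , k<1+n , eq)
  with ⨆-attained b k (λ j → (k ∸ x) C (j ∸ x)) | bound-attained sh n k (suc k) (n≤1+n k)
...   | inj₁ eq₀ | _ = inj₁ (trans eq (trans
  (cong (λ z → ((n ∸ x) C (k ∸ x)) * (z * bound n sh k (suc k))) (trans (cong (_C r zero) eq₀) (k>n⇒nCk≡0 1≤r₀)))
  (*-zeroʳ ((n ∸ x) C (k ∸ x)))))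
...   | inj₂ _ | inj₁ eq₀ = inj₁ (trans eq (trans
  (cong (((n ∸ x) C (k ∸ x)) *_) (trans
    (cong (((⨆ b k λ j → (k ∸ x) C (j ∸ x)) C r zero) *_) eq₀)
    (*-zeroʳ ((⨆ b k λ j → (k ∸ x) C (j ∸ x)) C r zero))))
  (*-zeroʳ ((n ∸ x) C (k ∸ x)))))
...   | inj₂ (j , b≤j , j<k , eq′) | inj₂ (ks , c , att) = inj₂
  ( j Vector.∷ k Vector.∷ ks
  , LevelChoice-cons b≤j (≤-trans (<⇒≤ j<k) k≤n) (LevelChoice-cons j<k k≤n c)
  , λ { X refl → begin
      bound n (two {r = r} 1≤r₀ r₁≡1 sh) x b
        ≡⟨ eq ⟩
      ((n ∸ x) C (k ∸ x)) * (((⨆ b k λ j → (k ∸ x) C (j ∸ x)) C r zero) * bound n sh k (suc k))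
        ≤⟨ ∑-above-level X (λ A → (length (between X A (level n j)) C r zero) * length (tuples sh (levels ks) A))
             (≤-trans x≤b b≤k) (λ { X⊆A refl → *-mono-≤
               (≤-reflexive (cong (_C r zero) (trans eq′ (sym (length-between-level′ X _ X⊆A (≤-trans x≤b b≤j))))))
               (att _ refl) }) ⟩
      ∑ (above X (level n k)) (λ A → (length (between X A (level n j)) C r zero) * length (tuples sh (levels ks) A))
        ≡⟨ length-tuples-two {r = r} 1≤r₀ r₁≡1 sh (levels (j Vector.∷ k Vector.∷ ks)) X ⟨
      length (tuples (two {r = r} 1≤r₀ r₁≡1 sh) (levels (j Vector.∷ k Vector.∷ ks)) X) ∎ })
  where
  open ≤-Reasoning
  k≤n = s≤s⁻¹ k<1+n

-- Copies cut out of a family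

∅⊆ : {X : Subset n} → ∅ ⊆ X
∅⊆ x∈∅ = ⊥-elim (∉⊥ x∈∅)

module _ (P : FinitePoset) where
  open FinitePoset P using (Carrier) renaming (_≤_ to _≤ᴾ_)

  -- A subfamily has to keep the order of `𝓕`, so a copy is obtained by filtering `𝓕` and not by
  -- listing the values of the map.
  filter-isCopyMap : {Q : Pred (Subset n) 0ℓ} (Q? : Decidable Q) {𝓕 : Family n}
    {φ : Carrier → Subset n} → Injective _≡_ _≡_ φ → (∀ x → φ x ∈ 𝓕) → (∀ x → Q (φ x)) →
    (∀ {A} → Q A → ∃[ x ] φ x ≡ A) → (∀ {x y} → x ≤ᴾ y → φ x ⊆ φ y) →
    IsCopyMap P (filter Q? 𝓕) φ
  filter-isCopyMap Q? {𝓕} inj into good onto mono =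
    inj , (λ x → ∈-filter⁺ Q? (into x) (good x)) ,
    (λ A∈ → onto (proj₂ (∈-filter⁻ Q? {xs = 𝓕} A∈))) , λ {x} {y} → mono {x} {y}

  IsFree⇒¬IsCopy : (𝓕 : Family n) {𝓖 : Family n} → IsFree P 𝓕 → 𝓖 ∈ subfamilies 𝓕 → ¬ IsCopy P 𝓖
  IsFree⇒¬IsCopy 𝓕 free 𝓖∈ copy with filter (isCopy? P) (subfamilies 𝓕) | ∈-filter⁺ (isCopy? P) 𝓖∈ copy
  IsFree⇒¬IsCopy 𝓕 () 𝓖∈ copy | _ ∷ _ | _

  ¬IsCopy⇒IsFree : (𝓕 : Family n) → (∀ {𝓖} → 𝓖 ∈ subfamilies 𝓕 → ¬ IsCopy P 𝓖) → IsFree P 𝓕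
  ¬IsCopy⇒IsFree 𝓕 h =
    cong length (filter-none (isCopy? P) {subfamilies 𝓕} (All.tabulate h))

  embedding⇒¬IsFree : {𝓕 : Family n} (φ : Carrier → Subset n) → Injective _≡_ _≡_ φ →
    (∀ x → φ x ∈ 𝓕) → (∀ {x y} → x ≤ᴾ y → φ x ⊆ φ y) → ¬ IsFree P 𝓕
  embedding⇒¬IsFree {𝓕 = 𝓕} φ inj into mono free = IsFree⇒¬IsCopy 𝓕 free
    (⊑⇒∈-subfamilies (Sublistₚ.filter-⊆ image? 𝓕))
    (φ , filter-isCopyMap image? inj into
      (λ x → ∈-map⁺ φ (FinitePoset.enumerates P x))
      (λ A∈ → let x , _ , e = ∈-map⁻ φ A∈ in x , sym e) mono)
    where
    image? : Decidable (_∈ map φ (FinitePoset.elements P))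
    image? A = A ∈ᶠ? map φ (FinitePoset.elements P)

-- Chains, depth and the layers of a family

infix 4 _◃_
-- Proper inclusion, with a strict inequality of sizes in place of `A ≢ B`, so that transitivity is
-- immediate.
record _◃_ (A B : Subset n) : Set where
  constructor proper
  field
    ◃⇒⊆ : A ⊆ B
    ◃⇒< : ∣ A ∣ < ∣ B ∣

open _◃_

_◃?_ : (A B : Subset n) → Dec (A ◃ B)
A ◃? B with A ⊆? B | ∣ A ∣ <? ∣ B ∣
... | yes A⊆B | yes A<B = yes (proper A⊆B A<B)
... | no  A⊈B | _       = no λ A◃B → A⊈B (◃⇒⊆ A◃B)
... | _       | no  A≮B = no λ A◃B → A≮B (◃⇒< A◃B)

◃-trans : {A B C : Subset n} → A ◃ B → B ◃ C → A ◃ C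
◃-trans p q = proper (λ x∈ → ◃⇒⊆ q (◃⇒⊆ p x∈)) (<-trans (◃⇒< p) (◃⇒< q))

module _ (𝓕 : Family n) where

  -- Some chain of k sets in `𝓕` lies strictly above `A`. The length of the longest such chain is
  -- then fixed by `Depth`.
  Below : ℕ → Pred (Subset n) 0ℓ
  Below zero    A = Unit
  Below (suc k) A = Any (λ B → A ◃ B × Below k B) 𝓕

  below? : ∀ k → Decidable (Below k)
  below? zero    A = yes tt
  below? (suc k) A = any? (λ B → (A ◃? B) ×-dec below? k B) 𝓕

  Below-pred : ∀ k {A} → Below (suc k) A → Below k A
  Below-pred zero    p = tt
  Below-pred (suc k) p = Any.map (λ (A◃B , q) → A◃B , Below-pred k q) p

  Below-≤ : ∀ {k l A} → k ≤ l → Below l A → Below k A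
  Below-≤ k≤l = go (≤⇒≤′ k≤l)
    where
    go : ∀ {k l A} → k ≤′ l → Below l A → Below k A
    go (≤′-reflexive refl) q = q
    go (≤′-step p)         q = go p (Below-pred _ q)

  ascent : ∀ k {A} → A ∈ 𝓕 → Below k A → Σ[ φ ∈ (Fin (suc k) → Subset n) ]
    (φ zero ≡ A × (∀ i → φ i ∈ 𝓕) × (∀ {i j} → i Fin.< j → φ i ◃ φ j))
  ascent zero    {A} A∈ p = (λ _ → A) , refl , (λ _ → A∈) , λ { {zero} {zero} () }
  ascent (suc k) {A} A∈ p with find p
  ... | B , B∈ , A◃B , q with ascent k B∈ q
  ...   | φ , refl , into , asc = A Vector.∷ φ , refl ,
      (λ { zero → A∈ ; (suc i) → into i }) , λ {i} {j} → up i j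
    where
    up : ∀ i j → i Fin.< j → (A Vector.∷ φ) i ◃ (A Vector.∷ φ) j
    up zero    (suc zero)    _   = A◃B
    up zero    (suc (suc j)) _   = ◃-trans A◃B (asc {zero} {suc j} z<s)
    up (suc i) (suc j)       i<j = asc (s<s⁻¹ i<j)

  ascending⇒¬IsFree : ∀ {k} {φ : Fin k → Subset n} → (∀ i → φ i ∈ 𝓕) →
    (∀ {i j} → i Fin.< j → φ i ◃ φ j) → ¬ IsFree (chain k) 𝓕
  ascending⇒¬IsFree {k} {φ} into asc = embedding⇒¬IsFree (chain k) φ inj into mono
    where
    inj : Injective _≡_ _≡_ φ
    inj {i} {j} e with Finₚ.<-cmp i j
    ... | tri< i<j _ _ = ⊥-elim (<-irrefl (cong ∣_∣ e) (◃⇒< (asc i<j)))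
    ... | tri≈ _ i≡j _ = i≡j
    ... | tri> _ _ j<i = ⊥-elim (<-irrefl (cong ∣_∣ (sym e)) (◃⇒< (asc j<i)))
    mono : ∀ {i j} → i Fin.≤ j → φ i ⊆ φ j
    mono {i} {j} i≤j with Finₚ.<-cmp i j
    ... | tri< i<j _ _  = ◃⇒⊆ (asc i<j)
    ... | tri≈ _ refl _ = λ x∈ → x∈
    ... | tri> _ _ j<i  = ⊥-elim (<⇒≱ j<i i≤j)

  ¬Below : ∀ {s A} → IsFree (chain (suc s)) 𝓕 → A ∈ 𝓕 → ¬ Below s A
  ¬Below {s} free A∈ p = let _ , _ , into , asc = ascent s A∈ p in ascending⇒¬IsFree into asc free

  Depth : ℕ → Pred (Subset n) 0ℓ
  Depth k A = Below k A × ¬ Below (suc k) A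

  depth? : ∀ k → Decidable (Depth k)
  depth? k A = below? k A ×-dec ¬? (below? (suc k) A)

  Depth-unique : ∀ {k l A} → Depth k A → Depth l A → k ≡ l
  Depth-unique {k} {l} (p , ¬p) (q , ¬q) with <-cmp k l
  ... | tri< k<l _ _ = ⊥-elim (¬p (Below-≤ k<l q))
  ... | tri≈ _ k≡l _ = k≡l
  ... | tri> _ _ l<k = ⊥-elim (¬q (Below-≤ l<k p))

-- The number of levels above level `i`; the successor appears because indices start at 0.
codepth : Fin s → ℕ
codepth {s} i = s ∸ suc (toℕ i)

codepth-injective : {i j : Fin s} → codepth i ≡ codepth j → i ≡ j
codepth-injective {i = i} {j} e = Finₚ.toℕ-injective (suc-injective
  (∸-cancelˡ-≡ (Finₚ.toℕ<n i) (Finₚ.toℕ<n j) e))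

-- Depth is measured in all of `𝓕`, even for sets of the subfamily `𝓖`, so that the slices of a copy
-- are sublists of the layers of `𝓕`.
slice : Family n → Family n → Fin s → Family n
slice 𝓕 𝓖 i = filter (depth? 𝓕 (codepth i)) 𝓖

layers : Family n → Fin s → Family n
layers 𝓕 = slice 𝓕 𝓕

slices : Family n → Family n → Vec (Family n) s
slices 𝓕 𝓖 = Vec.tabulate (slice 𝓕 𝓖)

-- A set properly contained in another one of its layer would have a chain above it that is longer
-- by one. A set in two layers would have two depths.
layers-layered : {𝓕 : Family n} → Unique 𝓕 → Layered {s = s} (layers 𝓕)
layers-layered {𝓕 = 𝓕} u = record
  { unique    = λ i → Uniqueₚ.filter⁺ (depth? 𝓕 (codepth i)) u
  ; antichain = λ i {A} {B} A∈ B∈ A⊆B → decidable-stable (A ≟ˢ B) λ A≢B →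
      let _ , _ , ¬deep = mem i A∈ ; B∈𝓕 , deep , _ = mem i B∈ in
      ¬deep (lose B∈𝓕 (proper A⊆B (⊆∧≢⇒∣∣< A⊆B A≢B) , deep))
  ; size-<    = λ {i} {j} i<j A∈ B∈ A⊆B → ⊆∧≢⇒∣∣< A⊆B λ { refl →
      <-irrefl (cong toℕ (codepth-injective {i = i} {j}
        (Depth-unique 𝓕 (proj₂ (mem i A∈)) (proj₂ (mem j B∈))))) i<j }
  }
  where
  mem : ∀ i {A} → A ∈ layers 𝓕 i → A ∈ 𝓕 × Depth 𝓕 (codepth i) A
  mem i = ∈-filter⁻ (depth? 𝓕 (codepth i)) {xs = 𝓕}

-- Copies in a chain-free family as tuples of layers

same-members⇒length-≡ : {xs ys : List A} → Unique xs → Unique ys →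
  (∀ {x} → x ∈ xs → x ∈ ys) → (∀ {x} → x ∈ ys → x ∈ xs) → length xs ≡ length ys
same-members⇒length-≡ u v f g = ≤-antisym
  (length-≤-by-injection id u f λ _ _ e → e) (length-≤-by-injection id v g λ _ _ e → e)

⊑-unique : {xs ys : List A} → xs ⊑ ys → Unique ys → Unique xs
⊑-unique []         _        = []
⊑-unique (y ∷ʳ p)   (_ ∷ u)  = ⊑-unique p u
⊑-unique (refl ∷ p) (y∉ ∷ u) = Sublistₚ.All-resp-⊆ p y∉ ∷ ⊑-unique p u

lookup-extensional : {u v : Vec A n} → (∀ i → Vec.lookup u i ≡ Vec.lookup v i) → u ≡ v
lookup-extensional {u = u} {v} h = trans (sym (Vecₚ.tabulate∘lookup u))
  (trans (Vecₚ.tabulate-cong h) (Vecₚ.tabulate∘lookup v))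

module _ {s} {r : Fin s → ℕ} (pos : ∀ i → 1 ≤ r i) {𝓕 : Family n} (u : Unique 𝓕)
         (free : IsFree (chain (suc s)) 𝓕) where

  private
    -- An arbitrary element of each level, for building chains that run through the levels of a
    -- copy.
    base : ∀ i → Fin (r i)
    base i = Fin.fromℕ< (pos i)

  module _ {𝓖 : Family n} (𝓖⊑𝓕 : 𝓖 ⊑ 𝓕) (φ : KCarrier r → Subset n)
           (isCopyMap : IsCopyMap (K r) 𝓖 φ) where

    private
      inj  = proj₁ isCopyMap
      into = proj₁ (proj₂ isCopyMap)
      onto = proj₁ (proj₂ (proj₂ isCopyMap))

    φ-◃ : ∀ {x y} → proj₁ x Fin.< proj₁ y → φ x ◃ φ y
    φ-◃ {x} {y} i<j = proper sub (⊆∧≢⇒∣∣< sub λ e → Finₚ.<-irrefl (cong proj₁ (inj e)) i<j)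
      where
      sub : φ x ⊆ φ y
      sub = proj₂ (proj₂ (proj₂ isCopyMap)) (inj₂ i<j)

    φ∈𝓕 : ∀ x → φ x ∈ 𝓕
    φ∈𝓕 x = ⊑-lookup 𝓖⊑𝓕 (into x)

    -- Climb through one set of each higher level of the copy.
    φ-below : ∀ m i h → toℕ i + suc m ≡ s → Below 𝓕 m (φ (i , h))
    φ-below zero    i h e = tt
    φ-below (suc m) i h e = lose (φ∈𝓕 (j , base j))
      (φ-◃ (≤-reflexive (sym j≡)) , φ-below m j (base j) (trans (cong (_+ suc m) j≡) (trans (sym (+-suc _ _)) e)))
      where
      i+1<s : suc (toℕ i) < s
      i+1<s = subst (suc (suc (toℕ i)) ≤_) e (≤-trans (≤-reflexive (+-comm 2 _)) (+-monoʳ-≤ (toℕ i) (s≤s (s≤s z≤n))))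
      j = Fin.fromℕ< i+1<s
      j≡ : toℕ j ≡ suc (toℕ i)
      j≡ = Finₚ.toℕ-fromℕ< i+1<s

    -- Suppose k sets of `𝓕` form a chain above a set of level m. Descending through one set of each
    -- lower level of the copy lengthens it to s sets above a set of level 0, hence to a chain of s
    -- + 1 sets, which `free` forbids.
    φ-¬below : ∀ m i h k → toℕ i ≡ m → k + m ≡ s → ¬ Below 𝓕 k (φ (i , h))
    φ-¬below zero    i h k e e′ p =
      ¬Below 𝓕 free (φ∈𝓕 (i , h)) (subst (λ k → Below 𝓕 k (φ (i , h))) (trans (sym (+-identityʳ k)) e′) p)
    φ-¬below (suc m) i h k e e′ p = φ-¬below m j (base j) (suc k) j≡ (trans (sym (+-suc k m)) e′)
      (lose (φ∈𝓕 (i , h)) (φ-◃ (≤-reflexive (trans (cong suc j≡) (sym e))) , p))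
      where
      m<s : m < s
      m<s = subst (suc m ≤_) e′ (m≤n+m _ k)
      j = Fin.fromℕ< m<s
      j≡ : toℕ j ≡ m
      j≡ = Finₚ.toℕ-fromℕ< m<s

    φ-depth : ∀ i h → Depth 𝓕 (codepth i) (φ (i , h))
    φ-depth i h =
      φ-below (codepth i) i h (trans (+-suc (toℕ i) _) (m+[n∸m]≡n (Finₚ.toℕ<n i))) ,
      φ-¬below (toℕ i) i h (suc (codepth i)) refl
        (trans (sym (+-suc (codepth i) _)) (m∸n+n≡m (Finₚ.toℕ<n i)))

    φ∈slice : ∀ i h → φ (i , h) ∈ slice 𝓕 𝓖 i
    φ∈slice i h = ∈-filter⁺ (depth? 𝓕 (codepth i)) (into (i , h)) (φ-depth i h)

    ∈-slice⁻ : ∀ i {A} → A ∈ slice 𝓕 𝓖 i → ∃[ h ] φ (i , h) ≡ A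
    ∈-slice⁻ i A∈ = let A∈𝓖 , depth = ∈-filter⁻ (depth? 𝓕 (codepth i)) {xs = 𝓖} A∈ in
      member (onto A∈𝓖) depth
      where
      member : ∀ {A} → ∃[ x ] φ x ≡ A → Depth 𝓕 (codepth i) A → ∃[ h ] φ (i , h) ≡ A
      member ((j , h) , refl) depth =
        -- By `φ-depth` the depth reveals the level, so `j` is `i`.
        subst (λ j → ∃[ h′ ] φ (j , h′) ≡ φ _)
          (sym (codepth-injective {i = i} {j} (Depth-unique 𝓕 depth (φ-depth j h)))) (h , refl)

    length-slice : ∀ i → length (slice 𝓕 𝓖 i) ≡ r i
    length-slice i = trans
      (same-members⇒length-≡ (Uniqueₚ.filter⁺ (depth? 𝓕 (codepth i)) (⊑-unique 𝓖⊑𝓕 u))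
        (Uniqueₚ.tabulate⁺ {f = λ h → φ (i , h)} (λ e → ,-injectiveʳ (inj e)))
        (λ A∈ → let h , e = ∈-slice⁻ i A∈ in subst (_∈ _) e (∈-tabulate⁺ h))
        (λ A∈ → let h , e = ∈-tabulate⁻ A∈ in subst (_∈ slice 𝓕 𝓖 i) (sym e) (φ∈slice i h)))
      (length-tabulate _)

    slices-isTuple : IsTuple r (layers 𝓕) ∅ (slices 𝓕 𝓖)
    slices-isTuple = record
      { sublist = λ i → subst (_⊑ layers 𝓕 i) (sym (Vecₚ.lookup∘tabulate (slice 𝓕 𝓖) i))
          (Sublistₚ.filter⁺ (depth? 𝓕 (codepth i)) (depth? 𝓕 (codepth i)) (λ { refl d → d }) 𝓖⊑𝓕)
      ; size    = λ i → trans (cong length (Vecₚ.lookup∘tabulate (slice 𝓕 𝓖) i)) (length-slice i)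
      ; lower   = λ _ _ → ∅⊆
      ; ordered = λ {i} {j} i<j A∈ B∈ → order i<j (member i A∈) (member j B∈)
      }
      where
      member : ∀ i {A} → A ∈ Vec.lookup (slices 𝓕 𝓖) i → ∃[ h ] φ (i , h) ≡ A
      member i A∈ = ∈-slice⁻ i (subst (_ ∈_) (Vecₚ.lookup∘tabulate (slice 𝓕 𝓖) i) A∈)
      order : ∀ {i j A B} → i Fin.< j → ∃[ h ] φ (i , h) ≡ A → ∃[ h ] φ (j , h) ≡ B → A ⊆ B
      order i<j (_ , refl) (_ , refl) = ◃⇒⊆ (φ-◃ i<j)

    -- Every set of a copy lies in the slice of its level, so no member of `𝓖` is lost. This gives
    -- the injectivity of `slices` on copies.
    slices-determine : {𝓗 : Family n} → slices 𝓕 𝓖 ≡ slices {s = s} 𝓕 𝓗 → ∀ {A} → A ∈ 𝓖 → A ∈ 𝓗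
    slices-determine {𝓗} e A∈𝓖 = member (onto A∈𝓖)
      where
      member : ∀ {A} → ∃[ x ] φ x ≡ A → A ∈ 𝓗
      member ((i , h) , refl) = proj₁ (∈-filter⁻ (depth? 𝓕 (codepth i)) {xs = 𝓗}
        (subst (φ (i , h) ∈_)
          (trans (sym (Vecₚ.lookup∘tabulate (slice 𝓕 𝓖) i))
            (trans (cong (λ v → Vec.lookup v i) e) (Vecₚ.lookup∘tabulate (slice 𝓕 𝓗) i)))
          (φ∈slice i h)))

  -- The slices depend on the subfamily and on `𝓕`, not on the copy map, so a copy is counted once
  -- however many copy maps it has.
  c≤length-tuples : (sh : Shape s r) → c (K r) 𝓕 ≤ length (tuples sh (layers 𝓕) ∅)
  c≤length-tuples sh = length-≤-by-injection (slices 𝓕)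
    (Uniqueₚ.filter⁺ (isCopy? (K r)) (subfamilies-unique u))
    (λ 𝓖∈ → let 𝓖⊑𝓕 , φ , isCopyMap = mem 𝓖∈ in
      tuples-complete sh (layers 𝓕) ∅ _ (slices-isTuple 𝓖⊑𝓕 φ isCopyMap))
    (λ 𝓖∈ 𝓗∈ e → let 𝓖⊑𝓕 , φ , isCopyMap = mem 𝓖∈ ; 𝓗⊑𝓕 , ψ , isCopyMap′ = mem 𝓗∈ in
      sublists-≡ u 𝓖⊑𝓕 𝓗⊑𝓕 (slices-determine 𝓖⊑𝓕 φ isCopyMap e) (slices-determine 𝓗⊑𝓕 ψ isCopyMap′ (sym e)))
    where
    mem : ∀ {𝓖} → 𝓖 ∈ filter (isCopy? (K r)) (subfamilies 𝓕) → 𝓖 ⊑ 𝓕 × IsCopy (K r) 𝓖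
    mem 𝓖∈ = let 𝓖∈′ , copy = ∈-filter⁻ (isCopy? (K r)) {xs = subfamilies 𝓕} 𝓖∈ in
      ∈-subfamilies⇒⊑ 𝓕 𝓖∈′ , copy

c≤bound : {r : Fin s → ℕ} → (∀ i → 1 ≤ r i) → (sh : Shape s r) {𝓕 : Family n} → Unique 𝓕 →
          IsFree (chain (suc s)) 𝓕 → c (K r) 𝓕 ≤ bound n sh 0 0
c≤bound {n = n} pos sh {𝓕} u free = ≤-trans (c≤length-tuples pos u free sh)
  (subst (λ x → length (tuples sh (layers 𝓕) ∅) ≤ bound n sh x 0) (∣⊥∣≡0 n)
    (length-tuples-≤ sh (layers-layered u) ∅ 0 (λ _ _ → z≤n)))

-- Unions of full levels

fullLevels : ∀ n → List ℕ → Family n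
fullLevels n ls = filter (λ A → ∣ A ∣ ∈ℕ? ls) 2^[ n ]

fullLevels-isUnionOfLevels : ∀ n ls → IsUnionOfLevels (fullLevels n ls)
fullLevels-isUnionOfLevels n ls = ls , λ A → mk⇔
  (λ A∈ → ∣ A ∣ , proj₂ (∈-filter⁻ (λ A → ∣ A ∣ ∈ℕ? ls) {xs = 2^[ n ]} A∈) ,
    ∈-filter⁺ (λ B → ∣ B ∣ ≟ ∣ A ∣) (∈-2^ A) refl)
  (λ (k , k∈ , A∈) → ∈-filter⁺ (λ A → ∣ A ∣ ∈ℕ? ls) (∈-2^ A)
    (subst (_∈ ls) (sym (∈-level⁻ A∈)) k∈))

-- Comparable sets of equal size coincide, so the elements of a chain have different sizes, hence
-- different positions in `ls`; there are at most `length ls` of them.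
fullLevels-isFree : ∀ n ls {k} → length ls < k → IsFree (chain k) (fullLevels n ls)
fullLevels-isFree n ls {k} ls<k = ¬IsCopy⇒IsFree (chain k) (fullLevels n ls) λ 𝓖∈ (φ , inj , into , _ , mono) →
  <⇒≱ ls<k (Finₚ.injective⇒≤ {f = λ i → index (size∈ls 𝓖∈ (into i))} λ {i} {j} e →
    let same = index-injective (size∈ls 𝓖∈ (into i)) (size∈ls 𝓖∈ (into j)) e in
    [ (λ i≤j → ≡-from-size inj i j (mono i≤j) same)
    , (λ j≤i → sym (≡-from-size inj j i (mono j≤i) (sym same))) ]′ (Finₚ.≤-total i j))
  where
  size∈ls : ∀ {𝓖 A} → 𝓖 ∈ subfamilies (fullLevels n ls) → A ∈ 𝓖 → ∣ A ∣ ∈ ls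
  size∈ls 𝓖∈ A∈ = proj₂ (∈-filter⁻ (λ A → ∣ A ∣ ∈ℕ? ls) {xs = 2^[ n ]}
    (⊑-lookup (∈-subfamilies⇒⊑ (fullLevels n ls) 𝓖∈) A∈))
  index-injective : ∀ {x y : ℕ} {xs} (p : x ∈ xs) (q : y ∈ xs) → index p ≡ index q → x ≡ y
  index-injective {xs = xs} p q e = trans (lookup-index p) (trans (cong (lookup xs) e) (sym (lookup-index q)))
  ≡-from-size : ∀ {φ : Fin k → Subset n} → Injective _≡_ _≡_ φ → ∀ i j → φ i ⊆ φ j →
    ∣ φ i ∣ ≡ ∣ φ j ∣ → i ≡ j
  ≡-from-size {φ} inj i j φi⊆φj e = decidable-stable (i Finₚ.≟ j) λ i≢j →
    <-irrefl e (⊆∧≢⇒∣∣< φi⊆φj (i≢j ∘ inj))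

-- Tuples of full levels as copies

module _ {n s} {r : Fin s → ℕ} (ks : Fin s → ℕ) (choice : LevelChoice n 0 ks) where

  private
    ls = tabulate ks
    𝓕 = fullLevels n ls

    ks-injective : ∀ {i j} → ks i ≡ ks j → i ≡ j
    ks-injective {i} {j} e with Finₚ.<-cmp i j
    ... | tri< i<j _ _ = ⊥-elim (<-irrefl e (increasing choice i<j))
    ... | tri≈ _ i≡j _ = i≡j
    ... | tri> _ _ j<i = ⊥-elim (<-irrefl (sym e) (increasing choice j<i))

  union? : (v : Vec (Family n) s) → Decidable (λ A → ∃[ i ] A ∈ Vec.lookup v i)
  union? v A = Finₚ.any? (λ i → A ∈ᶠ? Vec.lookup v i)

  union : Vec (Family n) s → Family n
  union v = filter (union? v) 𝓕

  module _ {v : Vec (Family n) s} (t : IsTuple r (levels ks) ∅ v) where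

    tuple-size : ∀ i {A} → A ∈ Vec.lookup v i → ∣ A ∣ ≡ ks i
    tuple-size i A∈ = ∈-level⁻ (⊑-lookup (sublist t i) A∈)

    tuple-⊆-𝓕 : ∀ i {A} → A ∈ Vec.lookup v i → A ∈ 𝓕
    tuple-⊆-𝓕 i {A} A∈ = ∈-filter⁺ (λ A → ∣ A ∣ ∈ℕ? ls) (∈-2^ A)
      (subst (_∈ ls) (sym (tuple-size i A∈)) (∈-tabulate⁺ i))

    tuple-⊑-2^ : ∀ i → Vec.lookup v i ⊑ 2^[ n ]
    tuple-⊑-2^ i = ⊆-trans (sublist t i) (Sublistₚ.filter-⊆ (λ A → ∣ A ∣ ≟ ks i) 2^[ n ])

    tuple-map : KCarrier r → Subset n
    tuple-map (i , h) = lookup (Vec.lookup v i) (Fin.cast (sym (size t i)) h)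

    -- The map sends `(i , h)` to the set at position `h` of the i-th list. Values on different
    -- levels differ in size, and values on one level differ because the list has no repetitions.
    union-isCopy : IsCopy (K r) (union v)
    union-isCopy = tuple-map , filter-isCopyMap (K r) (union? v) inj
      (λ (i , h) → tuple-⊆-𝓕 i (∈-lookup _))
      (λ (i , h) → i , ∈-lookup _)
      onto mono
      where
      inj : Injective _≡_ _≡_ tuple-map
      inj {i , h} {j , h′} e with ks-injective
        (trans (sym (tuple-size i (∈-lookup _))) (trans (cong ∣_∣ e) (tuple-size j (∈-lookup _))))
      ... | refl = cong (i ,_) (Finₚ.toℕ-injective (trans (sym (Finₚ.toℕ-cast (sym (size t i)) h))
        (trans (cong toℕ (Unique⇒lookup-injective (⊑-unique (tuple-⊑-2^ i) (2^-unique n)) e))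
          (Finₚ.toℕ-cast (sym (size t i)) h′))))
      onto : ∀ {A} → ∃[ i ] A ∈ Vec.lookup v i → ∃[ x ] tuple-map x ≡ A
      onto (i , A∈) = (i , Fin.cast (size t i) (index A∈)) , trans
        (cong (lookup (Vec.lookup v i)) (Finₚ.toℕ-injective
          (trans (Finₚ.toℕ-cast (sym (size t i)) _) (Finₚ.toℕ-cast (size t i) (index A∈)))))
        (sym (lookup-index A∈))
      mono : ∀ {x y} → FinitePoset._≤_ (K r) x y → tuple-map x ⊆ tuple-map y
      mono (inj₁ refl) = λ x∈ → x∈
      mono (inj₂ i<j)  = ordered t i<j (∈-lookup _) (∈-lookup _)

    -- The numbers `ks i` are distinct, so the size of a set tells its level and the tuple can be
    -- recovered from its union.
    union-determines : {w : Vec (Family n) s} → IsTuple r (levels ks) ∅ w → union v ≡ union w →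
      ∀ i {A} → A ∈ Vec.lookup v i → A ∈ Vec.lookup w i
    union-determines {w} t′ e i {A} A∈ with ∈-filter⁻ (union? w) {xs = 𝓕}
      (subst (A ∈_) e (∈-filter⁺ (union? v) (tuple-⊆-𝓕 i A∈) (i , A∈)))
    ... | _ , j , A∈′ with ks-injective {i} {j} (trans (sym (tuple-size i A∈)) (∈-level⁻ (⊑-lookup (sublist t′ j) A∈′)))
    ...   | refl = A∈′

  length-tuples≤c : (sh : Shape s r) → length (tuples sh (levels ks) ∅) ≤ c (K r) 𝓕
  length-tuples≤c sh = length-≤-by-injection union
    (tuples-unique sh (levels ks) ∅ (λ i → Uniqueₚ.filter⁺ (λ A → ∣ A ∣ ≟ ks i) (2^-unique n)))
    (λ {v} v∈ → ∈-filter⁺ (isCopy? (K r)) (⊑⇒∈-subfamilies (Sublistₚ.filter-⊆ (union? v) 𝓕)) (union-isCopy (sound v∈)))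
    (λ v∈ w∈ e → lookup-extensional λ i → sublists-≡ (2^-unique n)
      (tuple-⊑-2^ (sound v∈) i) (tuple-⊑-2^ (sound w∈) i)
      (union-determines (sound v∈) (sound w∈) e i) (union-determines (sound w∈) (sound v∈) (sym e) i))
    where
    sound : ∀ {v} → v ∈ tuples sh (levels ks) ∅ → IsTuple r (levels ks) ∅ v
    sound {v} = tuples-sound sh (levels ks) ∅ v

-- The extremal number

La-≡ : ∀ P Q {𝓕 : Family n} → 𝓕 ∈ subfamilies 2^[ n ] → IsFree P 𝓕 →
  (∀ {𝓖} → 𝓖 ∈ subfamilies 2^[ n ] → IsFree P 𝓖 → c Q 𝓖 ≤ c Q 𝓕) → La n P Q ≡ c Q 𝓕
La-≡ {n} P Q {𝓕} 𝓕∈ free best = ≤-antisym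
  (max≤v⁺ z≤n (All.tabulate λ m → let 𝓖 , 𝓖∈ , e = ∈-map⁻ (c Q) m
                                      𝓖∈′ , free′ = ∈-filter⁻ (λ 𝓖 → c P 𝓖 ≟ 0) {xs = subfamilies 2^[ n ]} 𝓖∈
                                  in subst (_≤ c Q 𝓕) (sym e) (best 𝓖∈′ free′)))
  (All.lookup (xs≤max 0 (map (c Q) (filter (λ 𝓖 → c P 𝓖 ≟ 0) (subfamilies 2^[ n ]))))
    (∈-map⁺ (c Q) (∈-filter⁺ (λ 𝓖 → c P 𝓖 ≟ 0) 𝓕∈ free)))

optimal-levels : {r : Fin s → ℕ} (sh : Shape s r) → ∀ n →
  ∃[ ls ] (length ls ≤ s × bound n sh 0 0 ≤ c (K r) (fullLevels n ls))
optimal-levels {r = r} sh n =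
  -- A zero bound may mean that no s distinct levels exist, as when s exceeds n + 1. The empty list
  -- of sizes then suffices, which is why `length ls` is only required to be at most `s`.
  [ (λ bound≡0 → [] , z≤n , ≤-trans (≤-reflexive bound≡0) z≤n)
  , (λ (ks , choice , attained) → tabulate ks , ≤-reflexive (length-tabulate ks) ,
       ≤-trans (attained ∅ (∣⊥∣≡0 n)) (length-tuples≤c ks choice sh))
  ]′ (bound-attained sh n 0 0 z≤n)

corollary1p12 : (s : ℕ) → 1 ≤ s →
    (r : Fin s → ℕ) → (∀ i → 1 ≤ r i) →
    (∀ i j → toℕ j ≡ suc (toℕ i) → r i ≡ 1 ⊎ r j ≡ 1) →
    ∃[ N ] (∀ n → N ≤ n →
    ∃[ 𝓕 ] ( 𝓕 ∈ subfamilies 2^[ n ]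
    × IsUnionOfLevels 𝓕
    × IsFree (chain (suc s)) 𝓕
    × La n (chain (suc s)) (K r) ≡ c (K r) 𝓕 ))
corollary1p12 s _ r pos alternating = 0 , λ n _ →
  let sh = shape r pos alternating
      ls , ls≤s , bound≤c = optimal-levels sh n
      𝓕∈ = ⊑⇒∈-subfamilies (Sublistₚ.filter-⊆ (λ A → ∣ A ∣ ∈ℕ? ls) 2^[ n ])
      free = fullLevels-isFree n ls (s≤s ls≤s)
  in fullLevels n ls , 𝓕∈ , fullLevels-isUnionOfLevels n ls , free ,
     La-≡ (chain (suc s)) (K r) 𝓕∈ free λ 𝓖∈ free′ →
       ≤-trans (c≤bound pos sh (⊑-unique (∈-subfamilies⇒⊑ _ 𝓖∈) (2^-unique n)) free′) bound≤c
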